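{- Let $m,n\geq 2$ and $c_{\mathrm{small}}\geq 0$ be integers, and let $c_{\mathrm{large}}\geq 2^n c_{\mathrm{small}}$ be an integer. Let $C:\mathbb{N}\times\mathbb{N}\to\mathbb{N}$ be a function such that for all integers $x,y$ and every tournament $T'$ in which every subtournament with clique number at least $y$ contains a copy of $D_{n-1}$, either $\overrightarrow{\omega}(T')<C(x,y)$, or $T'$ contains $D_n$, or $T'$ contains an $(x,y)$-$\overrightarrow{\omega}$-bag-chain of length $8$. Let $T$ be a tournament such that $T$ contains neither $A_m$ nor $D_n$, and every subtournament $T'$ of $T$ with $\overrightarrow{\omega}(T')\geq c_{\mathrm{small}}$ contains a copy of $A_{m-1}$ and a copy of $D_{n-1}$. Then $$\overrightarrow{\omega}(T)\leq 16m\max\{c_{\mathrm{large}},\ C(c_{\mathrm{large}},c_{\mathrm{small}}),\ (4\cdot m!+1)c_{\mathrm{small}}\}.$$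
   Context: A tournament is a finite directed graph with exactly one arc between each pair of distinct vertices; $N^+(v)$, $N^-(v)$ denote out- and in-neighbourhoods. For a total ordering $<$ of $V(T)$, the backedge graph $B(T,<)$ is the graph on $V(T)$ with an edge $uv$ for every pair $u<v$ with $vu \in A(T)$; $\overrightarrow{\omega}(T)=\min_<\omega(B(T,<))$ over all total orderings, and for $X\subseteq V(T)$, $\overrightarrow{\omega}(X)=\overrightarrow{\omega}(T[X])$. A tournament contains (a copy of) $H$ if some induced subtournament is isomorphic to $H$. For disjoint vertex sets $X,Y$, $X\Rightarrow Y$ means $xy$ is an arc for all $x\in X,y\in Y$. The tournament $A_1$ is a single vertex; for $k\ge 2$, $A_k$ consists of vertex-disjoint tournaments $T_1,\dots,T_{k-1}$, each isomorphic to $A_{k-1}$, and further vertices $v_1,\dots,v_k$, with: $A_k[V(T_i)]=T_i$; $v_j\Rightarrow v_i$ whenever $i<j$; $V(T_i)\Rightarrow V(T_j)$ whenever $i<j$; $v_i\Rightarrow V(T_j)$ whenever $i\le j$; and $V(T_j)\Rightarrow v_i$ whenever $i>j$. The tournament $D_1$ is a single vertex, and $D_k$ is obtained from two disjoint copies $T_1,T_2$ of $D_{k-1}$ and one further vertex $w$ with $V(T_1)\Rightarrow V(T_2)$, $V(T_2)\Rightarrow w$, $w \Rightarrow V(T_1)$. For integers $c',a$, a $(c',a)$-$\overrightarrow{\omega}$-bag-chain of length $t$ in a tournament is a tuple $(B_1,\dots,B_t)$ of pairwise disjoint vertex sets with $\overrightarrow{\omega}(B_i)=c'$ for all $i$,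 such that for all $1\le i<j\le t$: $\overrightarrow{\omega}(N^+(v)\cap B_i)<a$ for every $v\in B_j$, and $\overrightarrow{\omega}(N^-(w)\cap B_j)<a$ for every $w\in B_i$. (Such a function $C$ exists; the paper uses a specific one.) -}

module Defs where

open import Data.Nat using (ℕ; zero; suc; _+_; _*_; _∸_; _<_; _≤_; _<ᵇ_; _≡ᵇ_)
open import Data.Bool using (Bool; true; false; not; if_then_else_; _∧_)
open import Data.Fin using (Fin; toℕ)
open import Data.Fin.Subset using (Subset; _∈_; _⊆_; _∩_; ∣_∣)
open import Data.Vec using (tabulate)
open import Data.Product using (Σ; _×_; _,_; ∃)
open import Data.Sum using (_⊎_; inj₁; inj₂)
open import Data.Unit using (⊤; tt)
open import Data.Empty using (⊥)
open import Relation.Nullary using (¬_)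
open import Relation.Binary.PropositionalEquality using (_≡_; _≢_)
open import Function.Definitions using (Injective)

record Tour (n : ℕ) : Set where
  field
    arc    : Fin n → Fin n → Bool
    irrefl : ∀ i → arc i i ≡ false
    tourn  : ∀ i j → i ≢ j → arc i j ≡ not (arc j i)
open Tour public

record Pattern : Set₁ where
  field
    PV   : Set
    parc : PV → PV → Bool
open Pattern public

N⁺ : ∀ {n} → Tour n → Fin n → Subset n
N⁺ T v = tabulate (λ u → arc T v u)

N⁻ : ∀ {n} → Tour n → Fin n → Subset n
N⁻ T v = tabulate (λ u → arc T u v)

-- A total ordering of V(T) is given by an injective position map pos : Fin n → ℕ
-- (u < v iff pos u < pos v). Backedge between u and v in B(T,<):
Back : ∀ {n} → Tour n → (Fin n → ℕ) → Fin n → Fin n → Set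
Back T pos u v = (pos u < pos v × arc T v u ≡ true) ⊎ (pos v < pos u × arc T u v ≡ true)

CliqueLe : ∀ {n} → Tour n → Subset n → (Fin n → ℕ) → ℕ → Set
CliqueLe {n} T X pos k =
  (K : Subset n) → K ⊆ X → (∀ u v → u ∈ K → v ∈ K → u ≢ v → Back T pos u v) → ∣ K ∣ ≤ k

-- ω⃗(X) ≤ k : some total ordering has backedge clique number ≤ k
-- (orderings of X are the restrictions of orderings of V(T)).
OmegaLe : ∀ {n} → Tour n → Subset n → ℕ → Set
OmegaLe T X k = Σ (Fin _ → ℕ) λ pos → Injective _≡_ _≡_ pos × CliqueLe T X pos k

OmegaLt : ∀ {n} → Tour n → Subset n → ℕ → Set
OmegaLt T X a = Σ ℕ λ k → k < a × OmegaLe T X k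

OmegaEq : ∀ {n} → Tour n → Subset n → ℕ → Set
OmegaEq T X c = OmegaLe T X c × ¬ OmegaLt T X c

Contains : ∀ {n} → Tour n → Subset n → Pattern → Set
Contains {n} T X H =
  Σ (PV H → Fin n) λ f → Injective _≡_ _≡_ f × (∀ a → f a ∈ X)
    × (∀ a b → parc H a b ≡ arc T (f a) (f b))

-- Tournaments A_k. Index 0 is junk (= A_1).
AV : ℕ → Set
AV zero = ⊤
AV (suc zero) = ⊤
AV (suc (suc j)) = (Fin (suc j) × AV (suc j)) ⊎ Fin (suc (suc j))

Aarc : ∀ k → AV k → AV k → Bool
Aarc zero _ _ = false
Aarc (suc zero) _ _ = false
-- copies T_{s+1}, T_{t+1}: same copy → recurse, else T_s ⇒ T_t iff s < t
Aarc (suc (suc j)) (inj₁ (s , x)) (inj₁ (t , y)) =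
  if toℕ s ≡ᵇ toℕ t then Aarc (suc j) x y else (toℕ s <ᵇ toℕ t)
Aarc (suc (suc j)) (inj₂ a) (inj₂ b) = toℕ b <ᵇ toℕ a
-- v_{a+1} ⇒ V(T_{t+1}) iff a+1 ≤ t+1 iff a < t+1
Aarc (suc (suc j)) (inj₂ a) (inj₁ (t , _)) = toℕ a <ᵇ suc (toℕ t)
Aarc (suc (suc j)) (inj₁ (t , _)) (inj₂ a) = toℕ t <ᵇ toℕ a

A : ℕ → Pattern
A k = record { PV = AV k ; parc = Aarc k }

-- Tournaments D_k. Index 0 is junk (= D_1).
-- D_{k}: inj₁ (false , x) ∈ T_1, inj₁ (true , x) ∈ T_2, inj₂ tt = w.
DV : ℕ → Set
DV zero = ⊤
DV (suc zero) = ⊤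
DV (suc (suc j)) = (Bool × DV (suc j)) ⊎ ⊤

Darc : ∀ k → DV k → DV k → Bool
Darc zero _ _ = false
Darc (suc zero) _ _ = false
Darc (suc (suc j)) (inj₁ (false , x)) (inj₁ (false , y)) = Darc (suc j) x y
Darc (suc (suc j)) (inj₁ (true , x)) (inj₁ (true , y)) = Darc (suc j) x y
Darc (suc (suc j)) (inj₁ (false , x)) (inj₁ (true , y)) = true
Darc (suc (suc j)) (inj₁ (true , x)) (inj₁ (false , y)) = false
Darc (suc (suc j)) (inj₁ (true , x)) (inj₂ _) = true
Darc (suc (suc j)) (inj₁ (false , x)) (inj₂ _) = false
Darc (suc (suc j)) (inj₂ _) (inj₁ (false , y)) = true
Darc (suc (suc j)) (inj₂ _) (inj₁ (true , y)) = false
Darc (suc (suc j)) (inj₂ _) (inj₂ _) = false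

D : ℕ → Pattern
D k = record { PV = DV k ; parc = Darc k }

BagChain : ∀ {n} → Tour n → ℕ → ℕ → ℕ → Set
BagChain {n} T c' a t =
  Σ (Fin t → Subset n) λ B →
    (∀ i j → i ≢ j → ∀ v → v ∈ B i → v ∈ B j → ⊥)
    × (∀ i → OmegaEq T (B i) c')
    × (∀ (i j : Fin t) → toℕ i < toℕ j →
         (∀ v → v ∈ B j → OmegaLt T (N⁺ T v ∩ B i) a)
         × (∀ w → w ∈ B i → OmegaLt T (N⁻ T w ∩ B j) a))

V : ∀ {n} → Subset n
V = Data.Fin.Subset.⊤

{-# OPTIONS --safe #-}

-- Write s = c-small and L = c-large.  Deleting from X the in- (or out-) neighbourhoods of k
-- vertices, each of clique number < s on X, costs at most k s, so large sets joined by few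
-- backward arcs contain complete forward copies of the D's and A's.
--
-- Take an (L, s)-bag-chain.  Excluding D_n forces every vertex v to have a position: v
-- receives almost everything from earlier bags and dominates almost everything in later ones,
-- up to two bags.  For the same reason (using a bag in between) vertices whose positions
-- differ by at least 3 see few backward arcs, in both directions.  A zone (the vertices of one
-- position) of clique number at least C L s contains a chain of 8 bags, which can replace 6
-- bags of the chain; hence for a longest chain all zones are small.
--
-- Merge consecutive zones greedily into blocks of clique number between M and 2M, where M is
-- the maximum in the bound, and order T block by block.  A backedge clique meeting many blocks
-- contains m vertices pairwise at least 4 blocks apart; with copies of A_{m-1} taken from
-- blocks between them they form A_m.  So a clique meets at most 4m blocks, in at most 2M
-- vertices each.

module Submission where

open import Defs
open import Data.Bool using (true; false; not)
import Data.Bool.Properties as Bool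
open import Data.Empty using (⊥-elim) renaming (⊥ to Empty)
open import Data.Fin using (Fin; zero; suc; toℕ; fromℕ<; inject₁)
import Data.Fin.Properties as Fin
open import Data.Fin.Subset using (Subset; _∈_; _∉_; _⊆_; _∩_; _∪_; _─_; ∣_∣; ⁅_⁆; inside; outside; ⊥)
open import Data.Fin.Subset.Properties using (_∈?_; _⊆?_; anySubset?; nonempty?; Empty-unique; p⊆q⇒∣p∣≤∣q∣; p⊂q⇒∣p∣<∣q∣; ∣⊤∣≡n; ∣⊥∣≡0; ∈⊤; ∉⊥; ∣⁅x⁆∣≡1; x∈⁅x⁆; x∈⁅y⁆⇒x≡y; x∈p∩q⁺; x∈p∩q⁻; x∈p∪q⁺; x∈p∪q⁻; p∩q⊆p; p∩q⊆q; p─q⊆p; x∈p∧x∉q⇒x∈p─q)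
open import Data.List using (List; []; _∷_; _++_; length; map; allFin; cartesianProduct)
open import Data.List.Properties using (length-++; length-map; length-tabulate)
open import Data.List.Membership.Propositional using () renaming (_∈_ to _∈ˡ_)
open import Data.List.Membership.Propositional.Properties using (∈-map⁺; ∈-map⁻; ∈-++⁺ˡ; ∈-++⁺ʳ; ∈-allFin; ∈-cartesianProduct⁺)
open import Data.List.Relation.Unary.Any using (here; there)
open import Data.Nat using (ℕ; zero; suc; _+_; _*_; _∸_; _^_; _⊔_; _!; _≤_; _<_; _<ᵇ_; _≡ᵇ_; z≤n; s≤s; s≤s⁻¹; _≤?_; _<?_)
open import Data.Nat.Properties
open import Data.Nat.Solver using (module +-*-Solver)
open import Data.Product using (Σ; ∃; _×_; _,_; proj₁; proj₂)
open import Data.Sum using (_⊎_; inj₁; inj₂; [_,_]′)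
open import Data.Unit using (tt)
open import Data.Vec using (Vec; []; _∷_; here; there; tabulate; lookup)
open import Data.Vec.Properties using (lookup∘tabulate; lookup⇒[]=; []=⇒lookup)
open import Function using (_∘_; id)
open import Function.Definitions using (Injective)
open import Relation.Binary.Definitions using (tri<; tri≈; tri>)
open import Relation.Binary.PropositionalEquality using (_≡_; _≢_; refl; sym; trans; cong; cong₂; subst; subst₂; module ≡-Reasoning)
open import Relation.Nullary using (¬_; Dec; yes; no; does; contradiction)
open import Relation.Nullary.Decidable using (map′; _×-dec_; _⊎-dec_; _→-dec_; ¬?; decidable-stable; dec-true; dec-false)
open import Relation.Unary using (Decidable)

-- Subsets of Fin n

module _ {n : ℕ} where

  subset : {P : Fin n → Set} → Decidable P → Subset n
  subset P? = tabulate (does ∘ P?)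

  ∈-subset⁺ : {P : Fin n → Set} (P? : Decidable P) {v : Fin n} → P v → v ∈ subset P?
  ∈-subset⁺ P? {v} Pv =
    lookup⇒[]= v _ (trans (lookup∘tabulate (does ∘ P?) v) (dec-true (P? v) Pv))

  ∈-subset⁻ : {P : Fin n → Set} (P? : Decidable P) {v : Fin n} → v ∈ subset P? → P v
  ∈-subset⁻ P? {v} v∈ with P? v | trans (sym (lookup∘tabulate (does ∘ P?) v)) ([]=⇒lookup v∈)
  ... | yes Pv | _ = Pv
  ... | no _   | ()

  ∈-tabulate⁺ : ∀ {f v} → f v ≡ true → v ∈ tabulate {n = n} f
  ∈-tabulate⁺ {f} {v} eq = lookup⇒[]= v _ (trans (lookup∘tabulate f v) eq)

  ∈-tabulate⁻ : ∀ {f v} → v ∈ tabulate {n = n} f → f v ≡ true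
  ∈-tabulate⁻ {f} {v} v∈ = trans (sym (lookup∘tabulate f v)) ([]=⇒lookup v∈)

∈-─⇒∉ : ∀ {n} (p q : Subset n) {v} → v ∈ p ─ q → v ∉ q
∈-─⇒∉ (_ ∷ p) (outside ∷ q) (there v∈) (there v∈q) = ∈-─⇒∉ p q v∈ v∈q
∈-─⇒∉ (_ ∷ p) (inside  ∷ q) (there v∈) (there v∈q) = ∈-─⇒∉ p q v∈ v∈q

∩-monoʳ-⊆ : ∀ {n} (r : Subset n) {p q} → p ⊆ q → r ∩ p ⊆ r ∩ q
∩-monoʳ-⊆ r {p} p⊆q v∈ = let v∈r , v∈p = x∈p∩q⁻ r p v∈ in x∈p∩q⁺ (v∈r , p⊆q v∈p)

∣p∣≤∣p∩q∣+∣p─q∣ : ∀ {n} (p q : Subset n) → ∣ p ∣ ≤ ∣ p ∩ q ∣ + ∣ p ─ q ∣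
∣p∣≤∣p∩q∣+∣p─q∣ []            []            = z≤n
∣p∣≤∣p∩q∣+∣p─q∣ (outside ∷ p) (inside  ∷ q) = ∣p∣≤∣p∩q∣+∣p─q∣ p q
∣p∣≤∣p∩q∣+∣p─q∣ (outside ∷ p) (outside ∷ q) = ∣p∣≤∣p∩q∣+∣p─q∣ p q
∣p∣≤∣p∩q∣+∣p─q∣ (inside  ∷ p) (inside  ∷ q) = s≤s (∣p∣≤∣p∩q∣+∣p─q∣ p q)
∣p∣≤∣p∩q∣+∣p─q∣ (inside  ∷ p) (outside ∷ q) =
  subst (suc ∣ p ∣ ≤_) (sym (+-suc _ _)) (s≤s (∣p∣≤∣p∩q∣+∣p─q∣ p q))

enum : ∀ {n} (p : Subset n) → Fin ∣ p ∣ → Fin n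
enum (outside ∷ p) i       = suc (enum p i)
enum (inside  ∷ p) zero    = zero
enum (inside  ∷ p) (suc i) = suc (enum p i)

enum-∈ : ∀ {n} (p : Subset n) i → enum p i ∈ p
enum-∈ (outside ∷ p) i       = there (enum-∈ p i)
enum-∈ (inside  ∷ p) zero    = here
enum-∈ (inside  ∷ p) (suc i) = there (enum-∈ p i)

enum-injective : ∀ {n} (p : Subset n) → Injective _≡_ _≡_ (enum p)
enum-injective (outside ∷ p)                   eq = enum-injective p (Fin.suc-injective eq)
enum-injective (inside  ∷ p) {zero}  {zero}  eq = refl
enum-injective (inside  ∷ p) {suc i} {suc j} eq = cong suc (enum-injective p (Fin.suc-injective eq))

index : ∀ {n} (p : Subset n) {v} → v ∈ p → Fin ∣ p ∣
index (inside  ∷ p) here       = zero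
index (inside  ∷ p) (there v∈) = suc (index p v∈)
index (outside ∷ p) (there v∈) = index p v∈

enum-index : ∀ {n} (p : Subset n) {v} (v∈ : v ∈ p) → enum p (index p v∈) ≡ v
enum-index (inside  ∷ p) here       = refl
enum-index (inside  ∷ p) (there v∈) = cong suc (enum-index p v∈)
enum-index (outside ∷ p) (there v∈) = cong suc (enum-index p v∈)

-- `f` takes the membership proof, since the map may make sense on `p` only. Enumerating both sets
-- turns it into an injection between `Fin` types.
∣∣-injection : ∀ {a b} (p : Subset a) (q : Subset b) (f : ∀ {x} → x ∈ p → Fin b) →
  (∀ {x} (x∈ : x ∈ p) → f x∈ ∈ q) →
  (∀ {x y} (x∈ : x ∈ p) (y∈ : y ∈ p) → f x∈ ≡ f y∈ → x ≡ y) →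
  ∣ p ∣ ≤ ∣ q ∣
∣∣-injection p q f f∈q f-inj = Fin.injective⇒≤ g-injective
  where
  g : Fin ∣ p ∣ → Fin ∣ q ∣
  g i = index q (f∈q (enum-∈ p i))

  g-injective : Injective _≡_ _≡_ g
  g-injective {i} {j} eq = enum-injective p (f-inj (enum-∈ p i) (enum-∈ p j)
    (trans (sym (enum-index q (f∈q (enum-∈ p i))))
      (trans (cong (enum q) eq) (enum-index q (f∈q (enum-∈ p j))))))

anyVec? : ∀ {k} n {P : Vec (Fin k) n → Set} → Decidable P → Dec (∃ P)
anyVec? zero    P? = map′ (λ p → [] , p) (λ { ([] , p) → p }) (P? [])
anyVec? (suc n) P? =
  map′ (λ { (x , xs , p) → x ∷ xs , p }) (λ { (x ∷ xs , p) → x , xs , p })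
    (Fin.any? (λ x → anyVec? n (λ xs → P? (x ∷ xs))))

-- Orderings

-- With remainders below `N`, the number `a * N + r` encodes the lexicographic order of the pairs
-- `(a , r)`: orderings can be refined without leaving ℕ.
lex-< : ∀ {N a b r r′} → a < b → r < N → a * N + r < b * N + r′
lex-< {N} {a} {b} {r} {r′} a<b r<N = begin-strict
  a * N + r  <⟨ +-monoʳ-< (a * N) r<N ⟩
  a * N + N  ≡⟨ +-comm (a * N) N ⟩
  suc a * N  ≤⟨ *-monoˡ-≤ N a<b ⟩
  b * N      ≤⟨ m≤m+n (b * N) r′ ⟩
  b * N + r′ ∎
  where open ≤-Reasoning

lex-injective : ∀ {n N} (q r : Fin n → ℕ) → (∀ v → r v < N) →
  (∀ {u v} → q u ≡ q v → r u ≡ r v → u ≡ v) →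
  Injective _≡_ _≡_ (λ v → q v * N + r v)
lex-injective {N = N} q r r<N inj {u} {v} eq with <-cmp (q u) (q v)
... | tri< q< _ _ = contradiction eq (<⇒≢ (lex-< q< (r<N u)))
... | tri> _ _ q> = contradiction (sym eq) (<⇒≢ (lex-< q> (r<N v)))
... | tri≈ _ q≡ _ = inj q≡ (+-cancelˡ-≡ (q u * N) _ _
  (trans eq (cong (λ k → k * N + r v) (sym q≡))))

module _ {n : ℕ} (pos : Fin n → ℕ) where

  below : Fin n → Subset n
  below v = subset (λ u → pos u <? pos v)

  -- For injective `pos` this is the same ordering with values below `n`. The bound makes ranks
  -- usable as remainders in `lex-<` and leaves finitely many orderings to search.
  rank : Fin n → ℕ
  rank v = ∣ below v ∣

  ∉-below : ∀ v → v ∉ below v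
  ∉-below v v∈ = <-irrefl refl (∈-subset⁻ (λ u → pos u <? pos v) v∈)

  rank<n : ∀ v → rank v < n
  rank<n v = subst (rank v <_) (∣⊤∣≡n n)
    (p⊂q⇒∣p∣<∣q∣ ((λ _ → ∈⊤) , v , ∈⊤ , ∉-below v))

  rank-mono-< : ∀ {u v} → pos u < pos v → rank u < rank v
  rank-mono-< {u} {v} u<v = p⊂q⇒∣p∣<∣q∣
    ( (λ w∈ → ∈-subset⁺ (λ w → pos w <? pos v)
                (<-trans (∈-subset⁻ (λ w → pos w <? pos u) w∈) u<v))
    , u , ∈-subset⁺ (λ w → pos w <? pos v) u<v , ∉-below u )

  module _ (pos-inj : Injective _≡_ _≡_ pos) where

    rank-injective : Injective _≡_ _≡_ rank
    rank-injective {u} {v} eq with <-cmp (pos u) (pos v)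
    ... | tri< u<v _ _ = contradiction eq (<⇒≢ (rank-mono-< u<v))
    ... | tri≈ _ u≡v _ = pos-inj u≡v
    ... | tri> _ _ v<u = contradiction (sym eq) (<⇒≢ (rank-mono-< v<u))

    rank-cancel-< : ∀ {u v} → rank u < rank v → pos u < pos v
    rank-cancel-< {u} {v} ru<rv with <-cmp (pos u) (pos v)
    ... | tri< u<v _ _ = u<v
    ... | tri≈ _ u≡v _ = contradiction (cong rank (pos-inj u≡v)) (<⇒≢ ru<rv)
    ... | tri> _ _ v<u = contradiction (rank-mono-< v<u) (<⇒≯ ru<rv)

-- The tournament clique number

module _ {n : ℕ} (T : Tour n) where

  Clique : (Fin n → ℕ) → Subset n → Set
  Clique pos K = ∀ u v → u ∈ K → v ∈ K → u ≢ v → Back T pos u v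

  Back-map : ∀ {pos pos′ : Fin n → ℕ} {u v} →
    (pos u < pos v → pos′ u < pos′ v) → (pos v < pos u → pos′ v < pos′ u) →
    Back T pos u v → Back T pos′ u v
  Back-map f g (inj₁ (lt , a)) = inj₁ (f lt , a)
  Back-map f g (inj₂ (lt , a)) = inj₂ (g lt , a)

  -- Every backedge for `pos′` is then a backedge for `pos`, so every clique for `pos′` is one for
  -- `pos`.
  CliqueLe-reorder : ∀ {pos pos′ : Fin n → ℕ} {X k} →
    (∀ {u v} → pos′ u < pos′ v → pos u < pos v) →
    CliqueLe T X pos k → CliqueLe T X pos′ k
  CliqueLe-reorder f h K K⊆X K-clique =
    h K K⊆X λ u v u∈ v∈ u≢v → Back-map f f (K-clique u v u∈ v∈ u≢v)

  OmegaLe-mono : ∀ {X Y k l} → X ⊆ Y → k ≤ l → OmegaLe T Y k → OmegaLe T X l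
  OmegaLe-mono X⊆Y k≤l (pos , inj , h) =
    pos , inj , λ K K⊆X K-clique → ≤-trans (h K (X⊆Y ∘ K⊆X) K-clique) k≤l

  OmegaLt-mono : ∀ {X Y k l} → X ⊆ Y → k ≤ l → OmegaLt T Y k → OmegaLt T X l
  OmegaLt-mono X⊆Y k≤l (c , c<k , h) = c , <-≤-trans c<k k≤l , OmegaLe-mono X⊆Y ≤-refl h

  OmegaLt-∩ : ∀ R Q {X k} → OmegaLt T (R ∩ X) k → OmegaLt T (R ∩ (Q ∩ X)) k
  OmegaLt-∩ R Q {X} = OmegaLt-mono (∩-monoʳ-⊆ R (p∩q⊆q Q X)) ≤-refl

  OmegaLt⇒OmegaLe : ∀ {X k} → OmegaLt T X k → OmegaLe T X k
  OmegaLt⇒OmegaLe (c , c<k , h) = OmegaLe-mono (λ x → x) (<⇒≤ c<k) h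

  OmegaLe-bounded : ∀ {X k} → OmegaLe T X k →
    Σ (Fin n → ℕ) λ pos → Injective _≡_ _≡_ pos × (∀ v → pos v < n) × CliqueLe T X pos k
  OmegaLe-bounded (pos , inj , h) =
    rank pos , rank-injective pos inj , rank<n pos ,
    CliqueLe-reorder (rank-cancel-< pos inj) h

  -- Orderings of the sets W β, each cut down to b ⁻¹ (β), are concatenated by increasing β.
  OmegaLe-concat : (b : Fin n → ℕ) (W : ℕ → Subset n) (c : ℕ → ℕ) →
    (∀ β → OmegaLe T (W β) (c β)) →
    Σ (Fin n → ℕ) λ pos → Injective _≡_ _≡_ pos
      × (∀ {u v} → b u < b v → pos u < pos v)
      × (∀ β K → K ⊆ W β → (∀ {v} → v ∈ K → b v ≡ β) → Clique pos K → ∣ K ∣ ≤ c β)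
  OmegaLe-concat b W c h = pos , inj , (λ {u} bu<bv → lex-< bu<bv (r<n (b u) u)) , cliques
    where
    r : ℕ → Fin n → ℕ
    r β = proj₁ (OmegaLe-bounded (h β))
    r-inj : ∀ β → Injective _≡_ _≡_ (r β)
    r-inj β = proj₁ (proj₂ (OmegaLe-bounded (h β)))
    r<n : ∀ β v → r β v < n
    r<n β = proj₁ (proj₂ (proj₂ (OmegaLe-bounded (h β))))
    pos : Fin n → ℕ
    pos v = b v * n + r (b v) v
    inj : Injective _≡_ _≡_ pos
    inj = lex-injective b (λ v → r (b v) v) (λ v → r<n (b v) v)
      λ {u} {v} b≡ r≡ → r-inj (b u) (trans r≡ (cong (λ β → r β v) (sym b≡)))
    cliques : ∀ β K → K ⊆ W β → (∀ {v} → v ∈ K → b v ≡ β) → Clique pos K → ∣ K ∣ ≤ c β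
    cliques β K K⊆W b≡β K-clique =
      proj₂ (proj₂ (proj₂ (OmegaLe-bounded (h β)))) K K⊆W
        λ u v u∈ v∈ u≢v → Back-map (cancel u∈ v∈) (cancel v∈ u∈) (K-clique u v u∈ v∈ u≢v)
      where
      cancel : ∀ {u v} → u ∈ K → v ∈ K → pos u < pos v → r β u < r β v
      cancel u∈ v∈ lt rewrite b≡β u∈ | b≡β v∈ = +-cancelˡ-< (β * n) _ _ lt

  -- Subadditivity: with `X` placed before the rest of `Y`, a backedge clique splits into a clique
  -- inside `X` and one inside `Y`.
  OmegaLe-∪ : ∀ {X Y k l} → OmegaLe T X k → OmegaLe T Y l → OmegaLe T (X ∪ Y) (k + l)
  OmegaLe-∪ {X} {Y} {k} {l} hX hY = pos , inj , λ K K⊆X∪Y K-clique → begin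
      ∣ K ∣                   ≤⟨ ∣p∣≤∣p∩q∣+∣p─q∣ K X ⟩
      ∣ K ∩ X ∣ + ∣ K ─ X ∣   ≤⟨ +-mono-≤
        (cliques 0 (K ∩ X) (p∩q⊆q K X) (b≡0 ∘ p∩q⊆q K X)
          (λ u v u∈ v∈ → K-clique u v (p∩q⊆p K X u∈) (p∩q⊆p K X v∈)))
        (cliques 1 (K ─ X) (λ v∈ → in-Y K⊆X∪Y (p─q⊆p K X v∈) (∈-─⇒∉ K X v∈)) (b≡1 ∘ ∈-─⇒∉ K X)
          (λ u v u∈ v∈ → K-clique u v (p─q⊆p K X u∈) (p─q⊆p K X v∈))) ⟩
      k + l                   ∎
    where
    open ≤-Reasoning
    b : Fin n → ℕ
    b v with v ∈? X
    ... | yes _ = 0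
    ... | no  _ = 1
    -- `b` takes only the values 0 and 1; at larger indices `Y` is filler.
    W : ℕ → Subset n
    W zero    = X
    W (suc _) = Y
    c : ℕ → ℕ
    c zero    = k
    c (suc _) = l
    concat = OmegaLe-concat b W c λ { zero → hX ; (suc _) → hY }
    pos = proj₁ concat
    inj = proj₁ (proj₂ concat)
    cliques = proj₂ (proj₂ (proj₂ concat))
    b≡0 : ∀ {v} → v ∈ X → b v ≡ 0
    b≡0 {v} v∈ with v ∈? X
    ... | yes _ = refl
    ... | no v∉ = contradiction v∈ v∉
    b≡1 : ∀ {v} → v ∉ X → b v ≡ 1
    b≡1 {v} v∉ with v ∈? X
    ... | yes v∈ = contradiction v∈ v∉
    ... | no _   = refl
    in-Y : ∀ {K v} → K ⊆ X ∪ Y → v ∈ K → v ∉ X → v ∈ Y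
    in-Y K⊆ v∈K v∉X with x∈p∪q⁻ X Y (K⊆ v∈K)
    ... | inj₁ v∈X = contradiction v∈X v∉X
    ... | inj₂ v∈Y = v∈Y

  OmegaLe-⁅⁆ : ∀ v → OmegaLe T ⁅ v ⁆ 1
  OmegaLe-⁅⁆ v = toℕ , Fin.toℕ-injective ,
    λ K K⊆ _ → subst (∣ K ∣ ≤_) (∣⁅x⁆∣≡1 v) (p⊆q⇒∣p∣≤∣q∣ K⊆)

  OmegaLe-empty : ∀ {X k} → (∀ {v} → v ∉ X) → OmegaLe T X k
  OmegaLe-empty none = toℕ , Fin.toℕ-injective , λ K K⊆ _ →
    ≤-trans (p⊆q⇒∣p∣≤∣q∣ {q = ⊥} (λ v∈ → contradiction (K⊆ v∈) none))
      (≤-trans (≤-reflexive (∣⊥∣≡0 n)) z≤n)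

  CliqueLe? : ∀ X pos k → Dec (CliqueLe T X pos k)
  CliqueLe? X pos k = map′ no-large⇒bound bound⇒no-large (¬? (anySubset? large?))
    where
    Large : Subset n → Set
    Large K = K ⊆ X × Clique pos K × ¬ ∣ K ∣ ≤ k
    no-large⇒bound : ¬ ∃ Large → CliqueLe T X pos k
    no-large⇒bound none K K⊆ K-cl = decidable-stable (∣ K ∣ ≤? k) λ K≰k → none (K , K⊆ , K-cl , K≰k)
    bound⇒no-large : CliqueLe T X pos k → ¬ ∃ Large
    bound⇒no-large h (K , K⊆ , K-cl , K≰k) = K≰k (h K K⊆ K-cl)
    clique? : Decidable (Clique pos)
    clique? K = Fin.all? λ u → Fin.all? λ v →
      u ∈? K →-dec v ∈? K →-dec ¬? (u Fin.≟ v) →-dec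
        ((pos u <? pos v ×-dec arc T v u Bool.≟ true)
          ⊎-dec (pos v <? pos u ×-dec arc T u v Bool.≟ true))
    large? : Decidable Large
    large? K = K ⊆? X ×-dec clique? K ×-dec ¬? (∣ K ∣ ≤? k)

  abstract
    -- By `rank`, every ordering is equivalent to a vector of values in `Fin n`, so an exhaustive
    -- search decides. Being abstract, the search is never unfolded by its users.
    OmegaLe? : ∀ X k → Dec (OmegaLe T X k)
    OmegaLe? X k = map′
      (λ { (xs , inj , h) → toℕ ∘ lookup xs , (λ {u} {v} → inj u v) , h })
      (λ { (pos , inj , h) →
           let x = λ v → fromℕ< (rank<n pos v)
               toℕ-x : ∀ v → toℕ (lookup (tabulate x) v) ≡ rank pos v
               toℕ-x v = trans (cong toℕ (lookup∘tabulate x v)) (Fin.toℕ-fromℕ< (rank<n pos v))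
           in tabulate x
            , (λ u v eq → rank-injective pos inj (trans (sym (toℕ-x u)) (trans eq (toℕ-x v))))
            , CliqueLe-reorder
                (λ {u} {v} lt → rank-cancel-< pos inj (subst₂ _<_ (toℕ-x u) (toℕ-x v) lt)) h })
      (anyVec? {n} n λ xs →
        (Fin.all? λ u → Fin.all? λ v → toℕ (lookup xs u) ≟ toℕ (lookup xs v) →-dec u Fin.≟ v)
          ×-dec CliqueLe? X (toℕ ∘ lookup xs) k)

  OmegaLt? : ∀ X k → Dec (OmegaLt T X k)
  OmegaLt? X zero    = no λ ()
  OmegaLt? X (suc k) = map′ (λ h → k , ≤-refl , h)
    (λ { (c , s≤s c≤k , h) → OmegaLe-mono (λ x → x) c≤k h }) (OmegaLe? X k)

  OmegaLt-∪ : ∀ {X Y k l} → OmegaLe T X k → OmegaLt T Y l → OmegaLt T (X ∪ Y) (k + l)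
  OmegaLt-∪ {k = k} hX (c , c<l , hY) = k + c , +-monoʳ-< k c<l , OmegaLe-∪ hX hY

-- Bag-chains indexed by ℕ

module _ {n : ℕ} (T : Tour n) where

  record Linked (a : ℕ) (X Y : Subset n) : Set where
    field
      disjoint : ∀ {v} → v ∈ X → v ∉ Y
      few-out  : ∀ {v} → v ∈ Y → OmegaLt T (N⁺ T v ∩ X) a
      few-in   : ∀ {w} → w ∈ X → OmegaLt T (N⁻ T w ∩ Y) a

  -- Indexing by all of ℕ, with conditions only below `t`, lets chains be cut and glued without
  -- casts between `Fin` types.
  record Chain (c a t : ℕ) : Set where
    field
      bag    : ℕ → Subset n
      big    : ∀ {i} → i < t → ¬ OmegaLt T (bag i) c
      linked : ∀ {i j} → i < j → j < t → Linked a (bag i) (bag j)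

open Linked public
open Chain public

-- Induced subtournaments

module Induced {n : ℕ} (T : Tour n) (Z : Subset n) where

  private
    e : Fin ∣ Z ∣ → Fin n
    e = enum Z

  induced : Tour ∣ Z ∣
  induced .arc i j       = arc T (e i) (e j)
  induced .irrefl i      = irrefl T (e i)
  induced .tourn i j i≢j = tourn T (e i) (e j) (i≢j ∘ enum-injective Z)

  image : Subset ∣ Z ∣ → Subset n
  image X = subset (λ u → Fin.any? λ i → (i ∈? X) ×-dec (e i Fin.≟ u))

  ∈-image⁺ : ∀ {X i} → i ∈ X → e i ∈ image X
  ∈-image⁺ {X} {i} i∈ = ∈-subset⁺ (λ u → Fin.any? λ i → (i ∈? X) ×-dec (e i Fin.≟ u)) (i , i∈ , refl)

  ∈-image⁻ : ∀ {X u} → u ∈ image X → ∃ λ i → i ∈ X × e i ≡ u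
  ∈-image⁻ {X} = ∈-subset⁻ (λ u → Fin.any? λ i → (i ∈? X) ×-dec (e i Fin.≟ u))

  image⊆ : ∀ X → image X ⊆ Z
  image⊆ X u∈ with i , _ , refl ← ∈-image⁻ u∈ = enum-∈ Z i

  -- The ordering is pulled back along the enumeration of `Z`; a clique and its image have the same
  -- size.
  OmegaLe-restrict : ∀ {X Y k} → (∀ {i} → i ∈ X → e i ∈ Y) →
    OmegaLe T Y k → OmegaLe induced X k
  OmegaLe-restrict {X} {Y} X⊆Y (pos , inj , h) =
    pos ∘ e , enum-injective Z ∘ inj , λ K K⊆X K-clique →
      ≤-trans (∣∣-injection K (image K) (λ {i} _ → e i) ∈-image⁺ (λ _ _ → enum-injective Z))
        (h (image K) (image⊆Y K⊆X) (image-clique K-clique))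
    where
    image⊆Y : ∀ {K} → K ⊆ X → image K ⊆ Y
    image⊆Y K⊆X u∈ with i , i∈ , refl ← ∈-image⁻ u∈ = X⊆Y (K⊆X i∈)
    image-clique : ∀ {K} → Clique induced (pos ∘ e) K → Clique T pos (image K)
    image-clique cl u v u∈ v∈ u≢v
      with i , i∈ , refl ← ∈-image⁻ u∈ | j , j∈ , refl ← ∈-image⁻ v∈ = cl i j i∈ j∈ (u≢v ∘ cong e)

  -- The ordering must be extended to all of `Fin n`. Vertices outside `Z` get the value 0 and `toℕ`
  -- breaks ties; since `pos` is injective, tie-breaking never affects two vertices of `Z`.
  OmegaLe-extend : ∀ {X Y k} → (∀ {u} → u ∈ Y → ∃ λ i → i ∈ X × e i ≡ u) →
    OmegaLe induced X k → OmegaLe T Y k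
  OmegaLe-extend {X} {Y} Y⊆X (pos , inj , h) = pos⁺ , pos⁺-inj , bound
    where
    q : Fin n → ℕ
    q u with u ∈? Z
    ... | yes u∈ = pos (index Z u∈)
    ... | no _   = 0
    q-e : ∀ i → q (e i) ≡ pos i
    q-e i with e i ∈? Z
    ... | yes u∈ = cong pos (enum-injective Z (enum-index Z u∈))
    ... | no u∉  = contradiction (enum-∈ Z i) u∉
    pos⁺ : Fin n → ℕ
    pos⁺ u = q u * n + toℕ u
    pos⁺-inj : Injective _≡_ _≡_ pos⁺
    pos⁺-inj = lex-injective q toℕ Fin.toℕ<n (λ _ → Fin.toℕ-injective)
    cancel : ∀ {i j} → i ≢ j → pos⁺ (e i) < pos⁺ (e j) → pos i < pos j
    cancel {i} {j} i≢j lt with <-cmp (pos i) (pos j)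
    ... | tri< i<j _ _ = i<j
    ... | tri≈ _ i≡j _ = contradiction (inj i≡j) i≢j
    ... | tri> _ _ j<i = contradiction lt (<⇒≯
      (lex-< (subst₂ _<_ (sym (q-e j)) (sym (q-e i)) j<i) (Fin.toℕ<n (e j))))
    bound : CliqueLe T Y pos⁺ _
    bound K K⊆Y K-clique = ≤-trans
      (∣∣-injection K K′ (λ u∈ → proj₁ (Y⊆X (K⊆Y u∈)))
        (λ u∈ → let _ , _ , e≡ = Y⊆X (K⊆Y u∈) in
          ∈-subset⁺ ∈K? (subst (_∈ K) (sym e≡) u∈))
        (λ u∈ v∈ eq → let _ , _ , eu = Y⊆X (K⊆Y u∈) ; _ , _ , ev = Y⊆X (K⊆Y v∈) in
          trans (sym eu) (trans (cong e eq) ev)))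
      (h K′ K′⊆X λ i j i∈ j∈ i≢j → back i≢j
        (K-clique (e i) (e j) (∈-subset⁻ ∈K? i∈) (∈-subset⁻ ∈K? j∈) (i≢j ∘ enum-injective Z)))
      where
      ∈K? : ∀ i → Dec (e i ∈ K)
      ∈K? i = e i ∈? K
      K′ : Subset ∣ Z ∣
      K′ = subset ∈K?
      K′⊆X : K′ ⊆ X
      K′⊆X i∈ with j , j∈ , ej≡ ← Y⊆X (K⊆Y (∈-subset⁻ ∈K? i∈)) =
        subst (_∈ X) (enum-injective Z ej≡) j∈
      back : ∀ {i j} → i ≢ j → Back T pos⁺ (e i) (e j) → Back induced pos i j
      back i≢j (inj₁ (lt , a)) = inj₁ (cancel i≢j lt , a)
      back i≢j (inj₂ (lt , a)) = inj₂ (cancel (i≢j ∘ sym) lt , a)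

  OmegaLt-restrict : ∀ {X k} → OmegaLt T (image X) k → OmegaLt induced X k
  OmegaLt-restrict (c , c<k , h) = c , c<k , OmegaLe-restrict ∈-image⁺ h

  OmegaLt-extend : ∀ {X Y k} → (∀ {u} → u ∈ Y → ∃ λ i → i ∈ X × e i ≡ u) →
    OmegaLt induced X k → OmegaLt T Y k
  OmegaLt-extend Y⊆X (c , c<k , h) = c , c<k , OmegaLe-extend Y⊆X h

  OmegaLt-extend-V : ∀ {k} → OmegaLt induced V k → OmegaLt T Z k
  OmegaLt-extend-V = OmegaLt-extend (λ u∈ → index Z u∈ , ∈⊤ , enum-index Z u∈)

  Contains-restrict : ∀ {X H} → Contains T (image X) H → Contains induced X H
  Contains-restrict {X} {H} (f , inj , f∈ , arcs) =
    g , (λ eq → inj (trans (sym (eg _)) (trans (cong e eq) (eg _)))) ,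
    (λ a → proj₁ (proj₂ (∈-image⁻ (f∈ a)))) ,
    λ a b → trans (arcs a b) (sym (cong₂ (arc T) (eg a) (eg b)))
    where
    g : PV H → Fin ∣ Z ∣
    g a = proj₁ (∈-image⁻ (f∈ a))
    eg : ∀ a → e (g a) ≡ f a
    eg a = proj₂ (proj₂ (∈-image⁻ (f∈ a)))

  Contains-extend : ∀ {X H} → Contains induced X H → Contains T V H
  Contains-extend (f , inj , _ , arcs) = e ∘ f , inj ∘ enum-injective Z , (λ _ → ∈⊤) , arcs

  BagChain-extend : ∀ {c a t} → BagChain induced c a t →
    Σ (Chain T c a t) λ 𝓑 → ∀ i → bag 𝓑 i ⊆ Z
  BagChain-extend {c} {a} {t} (B , disj , ω≡c , links) =
    record { bag = bags ; big = bags-big ; linked = bags-linked } , bags⊆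
    where
    at : ∀ {i} → Dec (i < t) → Subset n
    at (yes i<t) = image (B (fromℕ< i<t))
    -- Indices from `t` on get the empty bag, which keeps all bags inside `Z`.
    at (no _)    = ⊥
    bags : ℕ → Subset n
    bags i = at (i <? t)
    bags⊆ : ∀ i → bags i ⊆ Z
    bags⊆ i with i <? t
    ... | yes i<t = image⊆ (B (fromℕ< i<t))
    ... | no _    = ⊥-elim ∘ ∉⊥
    bags-big : ∀ {i} → i < t → ¬ OmegaLt T (bags i) c
    bags-big {i} i<t with i <? t
    ... | yes p = proj₂ (ω≡c (fromℕ< p)) ∘ OmegaLt-restrict
    ... | no i≮t = contradiction i<t i≮t
    link : ∀ {i j : Fin t} → toℕ i < toℕ j → Linked T a (image (B i)) (image (B j))
    link i<j .disjoint v∈i v∈j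
      with k , k∈ , refl ← ∈-image⁻ v∈i | l , l∈ , el≡ ← ∈-image⁻ v∈j
      with refl ← enum-injective Z el≡ = disj _ _ (λ { refl → <-irrefl refl i<j }) k k∈ l∈
    link {i} {j} i<j .few-out v∈ with l , l∈ , refl ← ∈-image⁻ v∈ =
      OmegaLt-extend
        (λ u∈ → let uN , ui = x∈p∩q⁻ (N⁺ T (e l)) (image (B i)) u∈ in lift uN (∈-image⁻ ui))
        (proj₁ (links i j i<j) l l∈)
      where
      lift : ∀ {u} → u ∈ N⁺ T (e l) → (∃ λ k → k ∈ B i × e k ≡ u) →
        ∃ λ k → k ∈ N⁺ induced l ∩ B i × e k ≡ u
      lift uN (k , k∈ , refl) = k , x∈p∩q⁺ (∈-tabulate⁺ (∈-tabulate⁻ uN) , k∈) , refl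
    link {i} {j} i<j .few-in w∈ with l , l∈ , refl ← ∈-image⁻ w∈ =
      OmegaLt-extend
        (λ u∈ → let uN , uj = x∈p∩q⁻ (N⁻ T (e l)) (image (B j)) u∈ in lift uN (∈-image⁻ uj))
        (proj₂ (links i j i<j) l l∈)
      where
      lift : ∀ {u} → u ∈ N⁻ T (e l) → (∃ λ k → k ∈ B j × e k ≡ u) →
        ∃ λ k → k ∈ N⁻ induced l ∩ B j × e k ≡ u
      lift uN (k , k∈ , refl) = k , x∈p∩q⁺ (∈-tabulate⁺ (∈-tabulate⁻ uN) , k∈) , refl
    bags-linked : ∀ {i j} → i < j → j < t → Linked T a (bags i) (bags j)
    bags-linked {i} {j} i<j j<t with i <? t | j <? t
    ... | yes p | yes q = link (subst₂ _<_ (sym (Fin.toℕ-fromℕ< p)) (sym (Fin.toℕ-fromℕ< q)) i<j)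
    ... | no i≮t | _      = contradiction (<-trans i<j j<t) i≮t
    ... | yes _  | no j≮t = contradiction j<t j≮t

-- Large sets after the removal of small neighbourhoods

module _ {n : ℕ} (T : Tour n) where

  arc⇒≢ : ∀ {u v} → arc T u v ≡ true → u ≢ v
  arc⇒≢ {u} a refl with () ← trans (sym a) (irrefl T u)

  arc-asym : ∀ {u v} → arc T u v ≡ true → arc T v u ≡ false
  arc-asym {u} {v} a = trans (tourn T v u (arc⇒≢ a ∘ sym)) (cong not a)

  arc-total : ∀ {u v} → u ≢ v → arc T u v ≡ false → arc T v u ≡ true
  arc-total {u} {v} u≢v a = trans (tourn T v u (u≢v ∘ sym)) (cong not a)

  -- Arcs are irreflexive, so preserving them already forces injectivity.
  contains : ∀ {H X} (f : PV H → Fin n) →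
    (∀ a b → parc H a b ≡ false → parc H b a ≡ false → a ≡ b) →
    (∀ a → f a ∈ X) → (∀ a b → parc H a b ≡ arc T (f a) (f b)) → Contains T X H
  contains {H} f total f∈ arcs =
    f , (λ {a} {b} eq → total a b (no-arc a b eq) (no-arc b a (sym eq))) , f∈ , arcs
    where
    no-arc : ∀ a b → f a ≡ f b → parc H a b ≡ false
    no-arc a b eq = trans (arcs a b) (trans (cong (arc T (f a)) (sym eq)) (irrefl T (f a)))

  AtLeast : Subset n → ℕ → Set
  AtLeast X k = ¬ OmegaLt T X k

  AtLeast-mono : ∀ {X Y k l} → X ⊆ Y → l ≤ k → AtLeast X k → AtLeast Y l
  AtLeast-mono X⊆Y l≤k big = big ∘ OmegaLt-mono T X⊆Y l≤k

  -- By subadditivity each deleted set costs at most `s`, so `r` is left over at the end.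
  remove : ∀ (𝓢 : List (Subset n)) {X s r} →
    (∀ {S} → S ∈ˡ 𝓢 → OmegaLt T (S ∩ X) s) → AtLeast X (length 𝓢 * s + r) →
    ∃ λ Y → Y ⊆ X × (∀ {S w} → S ∈ˡ 𝓢 → w ∈ Y → w ∉ S) × AtLeast Y r
  remove []      {X} small big = X , id , (λ ()) , big
  remove (S ∷ 𝓢) {X} {s} {r} small big =
    let Y , Y⊆ , avoid , bigY = remove 𝓢
          (λ S∈ → OmegaLt-mono T (∩-monoʳ-⊆ _ (p─q⊆p X S)) ≤-refl (small (there S∈)))
          big′
    in Y , (λ w∈ → p─q⊆p X S (Y⊆ w∈))
         , (λ { (here refl) w∈ → ∈-─⇒∉ X S (Y⊆ w∈) ; (there S∈) w∈ → avoid S∈ w∈ })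
         , bigY
    where
    cover : X ⊆ (S ∩ X) ∪ (X ─ S)
    cover {w} w∈ with w ∈? S
    ... | yes w∈S = x∈p∪q⁺ (inj₁ (x∈p∩q⁺ (w∈S , w∈)))
    ... | no w∉S  = x∈p∪q⁺ (inj₂ (x∈p∧x∉q⇒x∈p─q w∈ w∉S))
    big′ : AtLeast (X ─ S) (length 𝓢 * s + r)
    big′ lt = big (OmegaLt-mono T cover (≤-reflexive (sym (+-assoc s (length 𝓢 * s) r)))
      (OmegaLt-∪ T (OmegaLt⇒OmegaLe T (small (here refl))) lt))

  N⁺-or-N⁻ : ∀ v {w} → w ≢ v → w ∈ N⁺ T v ⊎ w ∈ N⁻ T v
  N⁺-or-N⁻ v {w} w≢v with arc T v w in eq
  ... | true  = inj₁ (∈-tabulate⁺ eq)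
  ... | false = inj₂ (∈-tabulate⁺ (arc-total (w≢v ∘ sym) eq))

  -- The vertex v itself costs 1, which is paid for by the strict bound on S ∩ X.
  AtLeast-rest : ∀ v {S R X a b} → (∀ {w} → w ≢ v → w ∈ S ⊎ w ∈ R) →
    AtLeast X (a + b) → OmegaLt T (S ∩ X) a → AtLeast (R ∩ X) b
  AtLeast-rest v {S} {R} {X} {a} {b} S-or-R big (c , c<a , ωS) ωR =
    big (OmegaLt-mono T cover (+-monoˡ-≤ b c<a) (OmegaLt-∪ T (OmegaLe-∪ T (OmegaLe-⁅⁆ T v) ωS) ωR))
    where
    cover : X ⊆ (⁅ v ⁆ ∪ (S ∩ X)) ∪ (R ∩ X)
    cover {w} w∈ with w Fin.≟ v
    ... | yes refl = x∈p∪q⁺ (inj₁ (x∈p∪q⁺ (inj₁ (x∈⁅x⁆ w))))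
    ... | no w≢v with S-or-R w≢v
    ...   | inj₁ w∈S = x∈p∪q⁺ (inj₁ (x∈p∪q⁺ (inj₂ (x∈p∩q⁺ (w∈S , w∈)))))
    ...   | inj₂ w∈R = x∈p∪q⁺ (inj₂ (x∈p∩q⁺ (w∈R , w∈)))

  AtLeast-N⁺ : ∀ v {X a b} → AtLeast X (a + b) → OmegaLt T (N⁻ T v ∩ X) a → AtLeast (N⁺ T v ∩ X) b
  AtLeast-N⁺ v = AtLeast-rest v ([ inj₂ , inj₁ ]′ ∘ N⁺-or-N⁻ v)

  AtLeast-N⁻ : ∀ v {X a b} → AtLeast X (a + b) → OmegaLt T (N⁺ T v ∩ X) a → AtLeast (N⁻ T v ∩ X) b
  AtLeast-N⁻ v = AtLeast-rest v (N⁺-or-N⁻ v)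

  -- Once the out-neighbourhoods of `us` are removed, whatever remains dominates `us`. The premise
  -- `u ≢ w` is there because `u` is not its own out-neighbour and may survive the removal.
  avoid-N⁺ : ∀ us {X s r} → (∀ {u} → u ∈ˡ us → OmegaLt T (N⁺ T u ∩ X) s) →
    AtLeast X (length us * s + r) →
    ∃ λ Y → Y ⊆ X × (∀ {u w} → u ∈ˡ us → w ∈ Y → u ≢ w → arc T w u ≡ true) × AtLeast Y r
  avoid-N⁺ us {X} {s} {r} small big =
    let Y , Y⊆ , avoid , bigY = remove (map (N⁺ T) us)
          (λ S∈ → let u , u∈ , S≡ = ∈-map⁻ (N⁺ T) S∈
                  in subst (λ S → OmegaLt T (S ∩ X) s) (sym S≡) (small u∈))
          (subst (λ k → AtLeast X (k * s + r)) (sym (length-map (N⁺ T) us)) big)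
    in Y , Y⊆ , (λ u∈ w∈ u≢w → arc-total u≢w
         (Bool.¬-not (avoid (∈-map⁺ (N⁺ T) u∈) w∈ ∘ ∈-tabulate⁺))) , bigY

  avoid-N⁻ : ∀ us {X s r} → (∀ {u} → u ∈ˡ us → OmegaLt T (N⁻ T u ∩ X) s) →
    AtLeast X (length us * s + r) →
    ∃ λ Y → Y ⊆ X × (∀ {u w} → u ∈ˡ us → w ∈ Y → u ≢ w → arc T u w ≡ true) × AtLeast Y r
  avoid-N⁻ us {X} {s} {r} small big =
    let Y , Y⊆ , avoid , bigY = remove (map (N⁻ T) us)
          (λ S∈ → let u , u∈ , S≡ = ∈-map⁻ (N⁻ T) S∈
                  in subst (λ S → OmegaLt T (S ∩ X) s) (sym S≡) (small u∈))
          (subst (λ k → AtLeast X (k * s + r)) (sym (length-map (N⁻ T) us)) big)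
    in Y , Y⊆ , (λ u∈ w∈ u≢w → arc-total (u≢w ∘ sym)
         (Bool.¬-not (avoid (∈-map⁺ (N⁻ T) u∈) w∈ ∘ ∈-tabulate⁺))) , bigY

-- The tournaments D_k

Darc-total : ∀ k a b → Darc k a b ≡ false → Darc k b a ≡ false → a ≡ b
Darc-total zero          tt tt _ _ = refl
Darc-total (suc zero)    tt tt _ _ = refl
Darc-total (suc (suc k)) (inj₁ (false , x)) (inj₁ (false , y)) p q =
  cong (inj₁ ∘ (false ,_)) (Darc-total (suc k) x y p q)
Darc-total (suc (suc k)) (inj₁ (true , x)) (inj₁ (true , y)) p q =
  cong (inj₁ ∘ (true ,_)) (Darc-total (suc k) x y p q)
Darc-total (suc (suc k)) (inj₁ (false , x)) (inj₁ (true , y)) () q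
Darc-total (suc (suc k)) (inj₁ (true , x)) (inj₁ (false , y)) p ()
Darc-total (suc (suc k)) (inj₁ (false , x)) (inj₂ tt) p ()
Darc-total (suc (suc k)) (inj₁ (true , x)) (inj₂ tt) () q
Darc-total (suc (suc k)) (inj₂ tt) (inj₁ (false , x)) () q
Darc-total (suc (suc k)) (inj₂ tt) (inj₁ (true , x)) p ()
Darc-total (suc (suc k)) (inj₂ tt) (inj₂ tt) p q = refl

D-vertices : ∀ k → List (DV k)
D-vertices zero          = tt ∷ []
D-vertices (suc zero)    = tt ∷ []
D-vertices (suc (suc k)) =
  inj₂ tt ∷ map (inj₁ ∘ (false ,_)) (D-vertices (suc k)) ++ map (inj₁ ∘ (true ,_)) (D-vertices (suc k))

∈-D-vertices : ∀ k (a : DV k) → a ∈ˡ D-vertices k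
∈-D-vertices zero          tt                 = here refl
∈-D-vertices (suc zero)    tt                 = here refl
∈-D-vertices (suc (suc k)) (inj₂ tt)          = here refl
∈-D-vertices (suc (suc k)) (inj₁ (false , x)) = there (∈-++⁺ˡ (∈-map⁺ _ (∈-D-vertices (suc k) x)))
∈-D-vertices (suc (suc k)) (inj₁ (true , x))  =
  there (∈-++⁺ʳ (map (inj₁ ∘ (false ,_)) (D-vertices (suc k))) (∈-map⁺ _ (∈-D-vertices (suc k) x)))

-- The known order `2 ^ k - 1` of `D_k`. The additional 1 will pay for the `s` that must survive
-- when the neighbourhoods of a whole copy are removed.
∣D∣ : ∀ k → suc (length (D-vertices (suc k))) ≡ 2 ^ suc k
∣D∣ zero    = refl
∣D∣ (suc k) = begin
  suc (suc (length (map f₁ E ++ map f₂ E)))        ≡⟨ cong (2 +_) (length-++ (map f₁ E)) ⟩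
  suc (suc (length (map f₁ E) + length (map f₂ E))) ≡⟨ cong₂ (λ a b → suc (suc (a + b))) (length-map f₁ E) (length-map f₂ E) ⟩
  suc (suc (length E + length E))                   ≡⟨ cong suc (+-suc (length E) (length E)) ⟨
  suc (length E) + suc (length E)                   ≡⟨ cong₂ _+_ (∣D∣ k) (∣D∣ k) ⟩
  2 ^ suc k + 2 ^ suc k                             ≡⟨ cong (2 ^ suc k +_) (+-identityʳ _) ⟨
  2 ^ suc (suc k)                                   ∎
  where
  open ≡-Reasoning
  E = D-vertices (suc k)
  f₁ f₂ : DV (suc k) → DV (suc (suc k))
  f₁ = inj₁ ∘ (false ,_)
  f₂ = inj₁ ∘ (true ,_)

D-vertex : ∀ k → DV k
D-vertex zero          = tt
D-vertex (suc zero)    = tt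
D-vertex (suc (suc k)) = inj₂ tt

-- The value `t` encodes that no index below `t` satisfies `P`.
least : ∀ {P : ℕ → Set} → Decidable P → ∀ t →
  ∃ λ p → p ≤ t × (∀ {i} → i < p → ¬ P i) × (p < t → P p)
least P? zero = 0 , z≤n , (λ ()) , λ ()
least P? (suc t) with P? 0
... | yes P0 = 0 , z≤n , (λ ()) , λ _ → P0
... | no ¬P0 =
  let p , p≤t , none , found = least (P? ∘ suc) t
  in suc p , s≤s p≤t
     , (λ { {zero} _ → ¬P0 ; {suc i} (s≤s i<p) → none i<p })
     , λ { (s≤s p<t) → found p<t }

-- Cutting and gluing bag-chains

<∸⇒+< : ∀ {i t} k → i < t ∸ k → i + k < t
<∸⇒+< {i}         zero    i< = subst (_< _) (sym (+-identityʳ i)) i<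
<∸⇒+< {i} {suc t} (suc k) i< = subst (_< suc t) (sym (+-suc i k)) (s≤s (<∸⇒+< k i<))

splice : ∀ {n} → ℕ → (ℕ → Subset n) → (ℕ → Subset n) → ℕ → Subset n
splice s U W i with i <? s
... | yes _ = U i
... | no _  = W (i ∸ s)

∸-<-+ : ∀ {i s t} → ¬ i < s → i < s + t → i ∸ s < t
∸-<-+ {i} {s} {t} i≮s i<s+t = subst (i ∸ s <_) (m+n∸m≡n s t) (∸-monoˡ-< i<s+t (≮⇒≥ i≮s))

splice-elim : ∀ {n} {P : Subset n → Set} {U W s t} → (∀ {i} → i < s → P (U i)) →
  (∀ {i} → i < t → P (W i)) → ∀ {i} → i < s + t → P (splice s U W i)
splice-elim {s = s} f g {i} i< with i <? s
... | yes i<s = f i<s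
... | no i≮s  = g (∸-<-+ i≮s i<)

module _ {n : ℕ} {T : Tour n} {c a : ℕ} where

  concat : ∀ {s t} (𝓤 : Chain T c a s) (𝓦 : Chain T c a t) →
    (∀ {i j} → i < s → j < t → Linked T a (bag 𝓤 i) (bag 𝓦 j)) → Chain T c a (s + t)
  concat {s} {t} 𝓤 𝓦 link .bag = splice s (bag 𝓤) (bag 𝓦)
  concat {s} {t} 𝓤 𝓦 link .big =
    splice-elim {P = λ X → ¬ OmegaLt T X c} {bag 𝓤} {bag 𝓦} (big 𝓤) (big 𝓦)
  concat {s} {t} 𝓤 𝓦 link .linked {i} {j} i<j j< with i <? s | j <? s
  ... | yes _   | yes j<s = linked 𝓤 i<j j<s
  ... | yes i<s | no j≮s  = link i<s (∸-<-+ j≮s j<)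
  ... | no i≮s  | yes j<s = contradiction (<-trans i<j j<s) i≮s
  ... | no i≮s  | no j≮s  = linked 𝓦 (∸-monoˡ-< i<j (≮⇒≥ i≮s)) (∸-<-+ j≮s j<)

  prefix : ∀ {s t} → s ≤ t → Chain T c a t → Chain T c a s
  prefix s≤t 𝓑 .bag = bag 𝓑
  prefix s≤t 𝓑 .big i<s = big 𝓑 (<-≤-trans i<s s≤t)
  prefix s≤t 𝓑 .linked i<j j<s = linked 𝓑 i<j (<-≤-trans j<s s≤t)

  suffix : ∀ {t} k → Chain T c a t → Chain T c a (t ∸ k)
  suffix {t} k 𝓑 .bag i = bag 𝓑 (i + k)
  suffix {t} k 𝓑 .big i< = big 𝓑 (<∸⇒+< k i<)
  suffix {t} k 𝓑 .linked i<j j< = linked 𝓑 (+-monoˡ-< k i<j) (<∸⇒+< k j<)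

-- Positions and zones in a tournament without `D_n`

module DFree {N : ℕ} (T : Tour N) (n s : ℕ)
  (D-free : ¬ Contains T V (D (suc (suc n))))
  (D-rich : ∀ X → AtLeast T X s → Contains T X (D (suc n))) where

  -- From a set this large, a neighbourhood smaller than `s` can be removed for each vertex of a
  -- copy of `D (suc n)`, and the remainder still contains such a copy.
  h : ℕ
  h = 2 ^ suc n * s

  private
    ∣D∣s+s≡h : ∀ (f : DV (suc n) → Fin N) → length (map f (D-vertices (suc n))) * s + s ≡ h
    ∣D∣s+s≡h f = begin
      length (map f (D-vertices (suc n))) * s + s ≡⟨ cong (λ l → l * s + s) (length-map f (D-vertices (suc n))) ⟩
      length (D-vertices (suc n)) * s + s         ≡⟨ +-comm _ s ⟩
      suc (length (D-vertices (suc n))) * s       ≡⟨ cong (_* s) (∣D∣ n) ⟩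
      h                                           ∎
      where open ≡-Reasoning

  member : ∀ {X} → AtLeast T X s → ∃ λ v → v ∈ X
  member {X} big = let f , _ , f∈ , _ = D-rich X big in f (D-vertex (suc n)) , f∈ (D-vertex (suc n))

  s≤h : s ≤ h
  s≤h = m≤n*m s (2 ^ suc n) {{m^n≢0 2 (suc n)}}

  -- The vertex `v` acts as `w`, the copy in `X` as `T_1` and the copy in `Y` as `T_2` of the
  -- excluded tournament.
  no-D-triangle : ∀ v {X Y} (X-copy : Contains T X (D (suc n))) (Y-copy : Contains T Y (D (suc n))) →
    X ⊆ N⁺ T v → Y ⊆ N⁻ T v →
    (∀ a b → arc T (proj₁ X-copy a) (proj₁ Y-copy b) ≡ true) → Empty
  no-D-triangle v {X} {Y} (f , _ , f∈ , f-arcs) (g , _ , g∈ , g-arcs) X⊆ Y⊆ fg =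
    D-free (contains T k (Darc-total (suc (suc n))) (λ _ → ∈⊤) arcs)
    where
    vf : ∀ a → arc T v (f a) ≡ true
    vf a = ∈-tabulate⁻ (X⊆ (f∈ a))
    gv : ∀ a → arc T (g a) v ≡ true
    gv a = ∈-tabulate⁻ (Y⊆ (g∈ a))
    k : DV (suc (suc n)) → Fin N
    k (inj₁ (false , a)) = f a
    k (inj₁ (true , a))  = g a
    k (inj₂ _)           = v
    arcs : ∀ a b → Darc (suc (suc n)) a b ≡ arc T (k a) (k b)
    arcs (inj₁ (false , a)) (inj₁ (false , b)) = f-arcs a b
    arcs (inj₁ (false , a)) (inj₁ (true , b))  = sym (fg a b)
    arcs (inj₁ (true , a))  (inj₁ (false , b)) = sym (arc-asym T (fg b a))
    arcs (inj₁ (true , a))  (inj₁ (true , b))  = g-arcs a b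
    arcs (inj₁ (false , a)) (inj₂ _)           = sym (arc-asym T (vf a))
    arcs (inj₁ (true , a))  (inj₂ _)           = sym (gv a)
    arcs (inj₂ _)           (inj₁ (false , b)) = sym (vf b)
    arcs (inj₂ _)           (inj₁ (true , b))  = sym (arc-asym T (gv b))
    arcs (inj₂ _)           (inj₂ _)           = sym (irrefl T v)

  module _ (v : Fin N) {X Y : Subset N} (X⊆ : X ⊆ N⁺ T v) (Y⊆ : Y ⊆ N⁻ T v) where

    private
      X≢Y : ∀ {x y} → x ∈ X → y ∈ Y → x ≢ y
      X≢Y x∈ y∈ refl with () ← trans (sym (∈-tabulate⁻ (Y⊆ y∈))) (arc-asym T (∈-tabulate⁻ (X⊆ x∈)))

    -- The copy in `X` is fixed first, which takes only `s`. Removing the in-neighbourhoods of its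
    -- vertices from `Y` takes `h` and leaves room for a second copy.
    no-triangle-few-in : AtLeast T X s → AtLeast T Y h →
      (∀ {x} → x ∈ X → OmegaLt T (N⁻ T x ∩ Y) s) → Empty
    no-triangle-few-in X-big Y-big few =
      let X-copy@(f , _ , f∈ , _) = D-rich X X-big
          Y′ , Y′⊆ , avoid , Y′-big = avoid-N⁻ T (map f (D-vertices (suc n)))
            (λ u∈ → let a , _ , u≡ = ∈-map⁻ f u∈ in few (subst (_∈ X) (sym u≡) (f∈ a)))
            (subst (AtLeast T Y) (sym (∣D∣s+s≡h f)) Y-big)
          Y-copy@(g , _ , g∈ , _) = D-rich Y′ Y′-big
      in no-D-triangle v X-copy Y-copy X⊆ (λ y∈ → Y⊆ (Y′⊆ y∈))
           λ a b → avoid (∈-map⁺ f (∈-D-vertices (suc n) a)) (g∈ b) (X≢Y (f∈ a) (Y′⊆ (g∈ b)))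

    -- The mirror image: the copy in `Y` comes first, so `X` is the set that has to be of size `h`.
    no-triangle-few-out : AtLeast T X h → AtLeast T Y s →
      (∀ {y} → y ∈ Y → OmegaLt T (N⁺ T y ∩ X) s) → Empty
    no-triangle-few-out X-big Y-big few =
      let Y-copy@(g , _ , g∈ , _) = D-rich Y Y-big
          X′ , X′⊆ , avoid , X′-big = avoid-N⁺ T (map g (D-vertices (suc n)))
            (λ u∈ → let a , _ , u≡ = ∈-map⁻ g u∈ in few (subst (_∈ Y) (sym u≡) (g∈ a)))
            (subst (AtLeast T X) (sym (∣D∣s+s≡h g)) X-big)
          X-copy@(f , _ , f∈ , _) = D-rich X′ X′-big
      in no-D-triangle v X-copy Y-copy (λ x∈ → X⊆ (X′⊆ x∈)) Y⊆
           λ a b → avoid (∈-map⁺ g (∈-D-vertices (suc n) b)) (f∈ a) (X≢Y (X′⊆ (f∈ a)) (g∈ b) ∘ sym)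

  module Zones (L : ℕ) (h+h≤L : h + h ≤ L) {t : ℕ} (𝓑 : Chain T L s t) where

    private
      bag-big : ∀ {i} → i < t → AtLeast T (bag 𝓑 i) (h + h)
      bag-big i<t = AtLeast-mono T id h+h≤L (big 𝓑 i<t)

      bag-big′ : ∀ {i} → i < t → AtLeast T (bag 𝓑 i) (s + h)
      bag-big′ i<t = AtLeast-mono T id (+-monoˡ-≤ h s≤h) (bag-big i<t)

      small : ∀ {X} → ¬ AtLeast T X s → OmegaLt T X s
      small = decidable-stable (OmegaLt? T _ s)

      search : ∀ v → ∃ λ p → p ≤ t
        × (∀ {i} → i < p → ¬ AtLeast T (N⁺ T v ∩ bag 𝓑 i) s)
        × (p < t → AtLeast T (N⁺ T v ∩ bag 𝓑 p) s)
      search v = least (λ i → ¬? (OmegaLt? T (N⁺ T v ∩ bag 𝓑 i) s)) t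

    -- Only out-neighbours enter this choice of the first bag receiving much from `v`. The matching
    -- statement about in-neighbours, `few-in-after`, comes from the absence of `D_n`.
    position : Fin N → ℕ
    position v = proj₁ (search v)

    position≤ : ∀ v → position v ≤ t
    position≤ v = proj₁ (proj₂ (search v))

    few-out-before : ∀ v {i} → i < position v → OmegaLt T (N⁺ T v ∩ bag 𝓑 i) s
    few-out-before v i<p = small (proj₁ (proj₂ (proj₂ (search v))) i<p)

    many-out-at : ∀ v → position v < t → AtLeast T (N⁺ T v ∩ bag 𝓑 (position v)) s
    many-out-at v = proj₂ (proj₂ (proj₂ (search v)))

    -- Bag `p + 1` lies between bag `p`, where `v` has many out-neighbours, and bag `j`, where it
    -- would have many in-neighbours. If `v` dominates much of bag `p + 1`, bags `p + 1` and `j`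
    -- give a triangle of copies; otherwise bags `p` and `p + 1` do.
    few-in-after : ∀ v {j} → 2 + position v ≤ j → j < t → OmegaLt T (N⁻ T v ∩ bag 𝓑 j) s
    few-in-after v {j} 2+p≤j j<t = small many-in⇒⊥
      where
      p = position v
      1+p<t : suc p < t
      1+p<t = <-trans 2+p≤j j<t
      many-in⇒⊥ : ¬ AtLeast T (N⁻ T v ∩ bag 𝓑 j) s
      many-in⇒⊥ many-in with OmegaLt? T (N⁻ T v ∩ bag 𝓑 (suc p)) h
      ... | yes few = no-triangle-few-out v (p∩q⊆p _ _) (p∩q⊆p _ _)
        (AtLeast-N⁺ T v (bag-big 1+p<t) few) many-in
        λ y∈ → OmegaLt-∩ T _ (N⁺ T v)
          (few-out (linked 𝓑 2+p≤j j<t) (p∩q⊆q (N⁻ T v) (bag 𝓑 j) y∈))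
      ... | no many = no-triangle-few-in v (p∩q⊆p _ _) (p∩q⊆p _ _)
        (many-out-at v (<-trans ≤-refl 1+p<t)) many
        λ x∈ → OmegaLt-∩ T _ (N⁻ T v)
          (few-in (linked 𝓑 ≤-refl 1+p<t) (p∩q⊆q (N⁺ T v) (bag 𝓑 p) x∈))

    position≥bag : ∀ {v q} → q < t → v ∈ bag 𝓑 q → q ≤ position v
    position≥bag {v} q<t v∈ = ≮⇒≥ λ p<q →
      many-out-at v (<-trans p<q q<t) (few-out (linked 𝓑 p<q q<t) v∈)

    -- Otherwise `v` would have both few out-neighbours and few in-neighbours in bag `q + 1`, which
    -- is too large for that.
    position≤1+bag : ∀ {v q} → v ∈ bag 𝓑 q → position v ≤ suc q
    position≤1+bag {v} {q} v∈ = ≮⇒≥ λ 1+q<p →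
      let 1+q<t = <-≤-trans 1+q<p (position≤ v) in
      AtLeast-mono T id s≤h
        (AtLeast-N⁺ T v (bag-big′ 1+q<t) (few-in (linked 𝓑 ≤-refl 1+q<t) v∈))
        (few-out-before v 1+q<p)

    -- A bag strictly between v and W would complete a D-copy inside N⁻ v ∩ W to a copy of D_n.
    few-in-later : ∀ v W → (∀ {w} → w ∈ W → 3 + position v ≤ position w) →
      OmegaLt T (N⁻ T v ∩ W) s
    -- A vertex of `W` has position at most `t`, which proves that bag `2 + position v` exists.
    few-in-later v W later = small λ many-in →
      let y , y∈ = member many-in
          i<t = <-≤-trans (later (p∩q⊆q (N⁻ T v) W y∈)) (position≤ y)
      in no-triangle-few-out v (p∩q⊆p _ _) (p∩q⊆p _ _)
           (AtLeast-N⁺ T v (bag-big′ i<t) (few-in-after v ≤-refl i<t)) many-in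
           λ {y} y∈ → OmegaLt-∩ T _ (N⁺ T v) (few-out-before y (later (p∩q⊆q (N⁻ T v) W y∈)))

    -- The bag `i` just below the position of `v` consists mostly of in-neighbours of `v`, and
    -- vertices of `W` receive little from it by `few-in-after`. Many out-neighbours of `v` in `W`
    -- would close a triangle of copies.
    few-out-earlier : ∀ v W → (∀ {w} → w ∈ W → 3 + position w ≤ position v) →
      OmegaLt T (N⁺ T v ∩ W) s
    few-out-earlier v W earlier = small (many-out⇒⊥ (position v) refl)
      where
      many-out⇒⊥ : ∀ p → position v ≡ p → ¬ AtLeast T (N⁺ T v ∩ W) s
      many-out⇒⊥ zero p≡ many-out =
        let x , x∈ = member many-out
        in n≮0 (subst (suc (2 + position x) ≤_) p≡ (earlier (p∩q⊆q (N⁺ T v) W x∈)))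
      many-out⇒⊥ (suc i) p≡ many-out =
        no-triangle-few-in v (p∩q⊆p _ _) (p∩q⊆p _ _) many-out
          (AtLeast-N⁻ T v (bag-big′ i<t) (few-out-before v i<p))
          λ {x} x∈ → OmegaLt-∩ T _ (N⁻ T v) (few-in-after x
            (s≤s⁻¹ (subst (3 + position x ≤_) p≡ (earlier (p∩q⊆q (N⁺ T v) W x∈)))) i<t)
        where
        i<p : i < position v
        i<p = ≤-reflexive (sym p≡)
        i<t : i < t
        i<t = <-≤-trans i<p (position≤ v)

    -- Links now depend on positions alone, so sets that are not bags of `𝓑` can join its bags in a
    -- new chain.
    far⇒Linked : ∀ {X Y} → (∀ {x y} → x ∈ X → y ∈ Y → 3 + position x ≤ position y) → Linked T s X Y
    far⇒Linked far .disjoint v∈X v∈Y = <-irrefl refl (m+n≤o⇒n≤o 2 (far v∈X v∈Y))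
    far⇒Linked far .few-out {v} v∈Y = few-out-earlier v _ (λ x∈ → far x∈ v∈Y)
    far⇒Linked far .few-in {w} w∈X = few-in-later w _ (λ y∈ → far w∈X y∈)

    -- Bags are nonempty and disjoint. This bound is what stops the repeated lengthening of chains.
    length≤N : t ≤ N
    length≤N = Fin.injective⇒≤ {f = λ i → proj₁ (pick i)} pick-injective
      where
      pick : (i : Fin t) → ∃ λ v → v ∈ bag 𝓑 (toℕ i)
      pick i = member (AtLeast-mono T id (m≤m+n s h) (bag-big′ (Fin.toℕ<n i)))
      pick-injective : Injective _≡_ _≡_ (λ i → proj₁ (pick i))
      pick-injective {i} {j} eq with <-cmp (toℕ i) (toℕ j)
      ... | tri< i<j _ _ = contradiction (subst (_∈ _) (sym eq) (proj₂ (pick j)))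
        (disjoint (linked 𝓑 i<j (Fin.toℕ<n j)) (proj₂ (pick i)))
      ... | tri≈ _ i≡j _ = Fin.toℕ-injective i≡j
      ... | tri> _ _ j<i = contradiction (subst (_∈ _) eq (proj₂ (pick i)))
        (disjoint (linked 𝓑 j<i (Fin.toℕ<n i)) (proj₂ (pick j)))

    zone : ℕ → Subset N
    zone k = subset (λ v → position v ≟ k)

    -- A chain inside zone k replaces the bags k − 3, …, k + 2.
    insert : ∀ {k l} → k ≤ t → (𝓜 : Chain T L s l) → (∀ i → bag 𝓜 i ⊆ zone k) →
      Chain T L s ((k ∸ 3 + l) + (t ∸ (3 + k)))
    insert {k} {l} k≤t 𝓜 𝓜⊆ = concat lower (suffix (3 + k) 𝓑)
      λ {i} {j} i< j< → far⇒Linked λ x∈ y∈ → ≤-trans (+-monoʳ-≤ 3 (lower≤k i< x∈))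
        (≤-trans (m≤n+m (3 + k) j) (position≥bag (<∸⇒+< (3 + k) j<) y∈))
      where
      𝓛 : Chain T L s (k ∸ 3)
      𝓛 = prefix (≤-trans (m∸n≤m k 3) k≤t) 𝓑
      at-k : ∀ {i v} → v ∈ bag 𝓜 i → position v ≡ k
      at-k {i} v∈ = ∈-subset⁻ (λ v → position v ≟ k) (𝓜⊆ i v∈)
      -- Vertices of bag `i` have position at most `i + 1`, and `i < k ∸ 3` gives `i + 4 ≤ k`. On
      -- the other side, bags from `k + 3` on have positions at least `k + 3`.
      3+𝓛≤k : ∀ {i v} → i < k ∸ 3 → v ∈ bag 𝓑 i → 3 + position v ≤ k
      3+𝓛≤k {i} i< v∈ = ≤-trans (+-monoʳ-≤ 3 (position≤1+bag v∈))
        (subst (_≤ k) (+-comm (suc i) 3) (<∸⇒+< 3 i<))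
      lower : Chain T L s (k ∸ 3 + l)
      lower = concat 𝓛 𝓜 λ i< _ → far⇒Linked λ x∈ y∈ →
        subst (_ ≤_) (sym (at-k y∈)) (3+𝓛≤k i< x∈)
      lower≤k : ∀ {i v} → i < k ∸ 3 + l → v ∈ bag lower i → position v ≤ k
      lower≤k {i} {v} i< = splice-elim {P = λ X → v ∈ X → position v ≤ k} {bag 𝓛} {bag 𝓜}
        (λ i< v∈ → m+n≤o⇒n≤o 3 (3+𝓛≤k i< v∈)) (λ _ v∈ → ≤-reflexive (at-k v∈)) i<

  -- Lengthening a chain until every zone is small

  module _ (L C : ℕ) (h+h≤L : h + h ≤ L)
    (dichotomy : ∀ Z → OmegaLt T Z C ⊎ (Σ (Chain T L s 8) λ 𝓜 → ∀ i → bag 𝓜 i ⊆ Z)) where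

    open Zones L h+h≤L

    -- What the rest of the argument retains of the final chain: the positions, small zones, and
    -- links at distance 3.
    Zoning : Set
    Zoning = Σ (Fin N → ℕ) λ p → Σ ℕ λ t → (∀ v → p v ≤ t)
      × (∀ k → OmegaLe T (subset (λ v → p v ≟ k)) C)
      × (∀ {X Y} → (∀ {x y} → x ∈ X → y ∈ Y → 3 + p x ≤ p y) → Linked T s X Y)

    -- A zone that is not small contains a chain of 8 bags, whose insertion lengthens the chain and
    -- consumes one unit of fuel. Fuel cannot run out, as the length never exceeds `N`.
    lengthen : ∀ fuel {t} → N < t + fuel → Chain T L s t → Zoning
    lengthen zero    {t} N< 𝓑 =
      contradiction (length≤N 𝓑) (<⇒≱ (subst (N <_) (+-identityʳ t) N<))
    lengthen (suc fuel) {t} N< 𝓑 with anyUpTo? (λ k → ¬? (OmegaLt? T (zone 𝓑 k) C)) (suc t)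
    ... | no none = position 𝓑 , t , position≤ 𝓑 , zone≤C , far⇒Linked 𝓑
      where
      zone≤C : ∀ k → OmegaLe T (zone 𝓑 k) C
      zone≤C k with k <? suc t
      ... | yes k≤t = OmegaLt⇒OmegaLe T
        (decidable-stable (OmegaLt? T (zone 𝓑 k) C) λ big → none (k , k≤t , big))
      ... | no k≰t  = OmegaLe-empty T λ {v} v∈ →
        k≰t (s≤s (subst (_≤ t) (∈-subset⁻ (λ v → position 𝓑 v ≟ k) v∈) (position≤ 𝓑 v)))
    ... | yes (k , s≤s k≤t , big) with dichotomy (zone 𝓑 k)
    ...   | inj₁ few = contradiction few big
    ...   | inj₂ (𝓜 , 𝓜⊆) = lengthen fuel
      (<-≤-trans N< (≤-trans (≤-reflexive (+-suc t fuel)) (+-monoˡ-≤ fuel longer))) (insert 𝓑 k≤t 𝓜 𝓜⊆)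
      where
      longer : suc t ≤ (k ∸ 3 + 8) + (t ∸ (3 + k))
      -- At most six bags are lost, fewer when a subtraction is truncated, and eight are gained.
      longer = begin
        suc t                              ≤⟨ s≤s (m≤n+m∸n t (3 + k)) ⟩
        4 + k + (t ∸ (3 + k))              ≤⟨ +-monoˡ-≤ (t ∸ (3 + k)) (+-monoʳ-≤ 4 (m≤n+m∸n k 3)) ⟩
        7 + (k ∸ 3) + (t ∸ (3 + k))        ≤⟨ +-monoˡ-≤ (t ∸ (3 + k)) (n≤1+n (7 + (k ∸ 3))) ⟩
        8 + (k ∸ 3) + (t ∸ (3 + k))        ≡⟨ cong (_+ (t ∸ (3 + k))) (+-comm 8 (k ∸ 3)) ⟩
        (k ∸ 3 + 8) + (t ∸ (3 + k))        ∎
        where open ≤-Reasoning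

    zoning : Zoning
    zoning = lengthen (suc N) {0} ≤-refl record { bag = λ _ → ⊥ ; big = λ () ; linked = λ _ () }

-- Merging consecutive zones into blocks

module Blocks {N : ℕ} (T : Tour N) (p : Fin N → ℕ) (t M : ℕ) (p≤t : ∀ v → p v ≤ t)
  (zone≤M : ∀ k → OmegaLe T (subset (λ v → p v ≟ k)) M) where

  private
    zone : ℕ → Subset N
    zone k = subset (λ v → p v ≟ k)

    next : ℕ × Subset N → Subset N → ℕ × Subset N
    next (β , X) Z with OmegaLe? T (X ∪ Z) (M + M)
    ... | yes _ = β , X ∪ Z
    ... | no  _ = suc β , Z

    state : ℕ → ℕ × Subset N
    state zero    = 0 , zone 0
    state (suc k) = next (state k) (zone (suc k))

  blockOf : ℕ → ℕ
  blockOf k = proj₁ (state k)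

  -- The part, up to zone k, of the block containing zone k.
  current : ℕ → Subset N
  current k = proj₂ (state k)

  -- The two outcomes of a greedy step as equations, so that later proofs match on them instead of
  -- unfolding `state`.
  data Step (k : ℕ) : Set where
    same : blockOf (suc k) ≡ blockOf k → current (suc k) ≡ current k ∪ zone (suc k) →
      OmegaLe T (current k ∪ zone (suc k)) (M + M) → Step k
    new  : blockOf (suc k) ≡ suc (blockOf k) → current (suc k) ≡ zone (suc k) →
      ¬ OmegaLe T (current k ∪ zone (suc k)) (M + M) → Step k

  step : ∀ k → Step k
  step k with OmegaLe? T (current k ∪ zone (suc k)) (M + M) in eq
  ... | yes h = same (cong proj₁ next≡) (cong proj₂ next≡) h
    where
    next≡ : next (state k) (zone (suc k)) ≡ (blockOf k , current k ∪ zone (suc k))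
    next≡ rewrite eq = refl
  ... | no ¬h = new (cong proj₁ next≡) (cong proj₂ next≡) ¬h
    where
    next≡ : next (state k) (zone (suc k)) ≡ (suc (blockOf k) , zone (suc k))
    next≡ rewrite eq = refl

  zone≤2M : ∀ k → OmegaLe T (zone k) (M + M)
  zone≤2M k = OmegaLe-mono T id (m≤m+n M M) (zone≤M k)

  current≤2M : ∀ k → OmegaLe T (current k) (M + M)
  current≤2M zero = zone≤2M 0
  current≤2M (suc k) with step k
  ... | same _ c≡ h = subst (λ X → OmegaLe T X (M + M)) (sym c≡) h
  ... | new _ c≡ _  = subst (λ X → OmegaLe T X (M + M)) (sym c≡) (zone≤2M (suc k))

  blockOf-step : ∀ k → blockOf k ≤ blockOf (suc k)
  blockOf-step k with step k
  ... | same b≡ _ _ = ≤-reflexive (sym b≡)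
  ... | new b≡ _ _  = ≤-trans (n≤1+n _) (≤-reflexive (sym b≡))

  blockOf-step≤ : ∀ k → blockOf (suc k) ≤ suc (blockOf k)
  blockOf-step≤ k with step k
  ... | same b≡ _ _ = ≤-trans (≤-reflexive b≡) (n≤1+n _)
  ... | new b≡ _ _  = ≤-reflexive b≡

  blockOf-mono : ∀ {k l} → k ≤ l → blockOf k ≤ blockOf l
  blockOf-mono {k} {zero}  z≤n = ≤-refl
  blockOf-mono {k} {suc l} k≤ with m≤n⇒m<n∨m≡n k≤
  ... | inj₁ (s≤s k≤l) = ≤-trans (blockOf-mono k≤l) (blockOf-step l)
  ... | inj₂ refl      = ≤-refl

  -- Two consecutive zones always fit into one block, as each has clique number at most M.
  blockOf-2+ : ∀ k → blockOf (2 + k) ≤ suc (blockOf k)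
  blockOf-2+ k with step k
  ... | same b≡ _ _ = ≤-trans (blockOf-step≤ (suc k)) (s≤s (≤-reflexive b≡))
  ... | new b≡ c≡ _ with step (suc k)
  ...   | same b′≡ _ _ = ≤-reflexive (trans b′≡ b≡)
  ...   | new _ _ ¬h   = contradiction
    (OmegaLe-∪ T (subst (λ X → OmegaLe T X M) (sym c≡) (zone≤M (suc k))) (zone≤M (2 + k))) ¬h

  -- Since two zones further on the block number has grown by at most 1, distance 2 between blocks
  -- yields the distance 3 between positions that links require.
  blockOf-far : ∀ {i j} → 2 + blockOf i ≤ blockOf j → 3 + i ≤ j
  blockOf-far {i} {j} far = ≮⇒≥ λ { (s≤s j≤2+i) →
    <-irrefl refl (≤-trans far (≤-trans (blockOf-mono j≤2+i) (blockOf-2+ i))) }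

  ∈-current⁺ : ∀ {v} k → p v ≤ k → blockOf (p v) ≡ blockOf k → v ∈ current k
  ∈-current⁺ zero p≤0 _ = ∈-subset⁺ (λ v → p v ≟ 0) (n≤0⇒n≡0 p≤0)
  ∈-current⁺ {v} (suc k) p≤ b≡ with step k | m≤n⇒m<n∨m≡n p≤
  ... | same b′≡ c≡ _ | inj₁ (s≤s p≤k) =
    subst (v ∈_) (sym c≡) (x∈p∪q⁺ (inj₁ (∈-current⁺ k p≤k (trans b≡ b′≡))))
  ... | same _ c≡ _   | inj₂ p≡ =
    subst (v ∈_) (sym c≡) (x∈p∪q⁺ (inj₂ (∈-subset⁺ (λ v → p v ≟ suc k) p≡)))
  ... | new b′≡ _ _   | inj₁ (s≤s p≤k) =
    contradiction (≤-trans (≤-reflexive (sym (trans b≡ b′≡))) (blockOf-mono p≤k)) (<-irrefl refl)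
  ... | new _ c≡ _    | inj₂ p≡ =
    subst (v ∈_) (sym c≡) (∈-subset⁺ (λ v → p v ≟ suc k) p≡)

  ∈-current⁻ : ∀ {v} k → v ∈ current k → blockOf (p v) ≡ blockOf k
  ∈-current⁻ zero v∈ = cong blockOf (∈-subset⁻ (λ v → p v ≟ 0) v∈)
  ∈-current⁻ {v} (suc k) v∈ with step k
  ... | new _ c≡ _  = cong blockOf (∈-subset⁻ (λ v → p v ≟ suc k) (subst (v ∈_) c≡ v∈))
  ... | same b≡ c≡ _ with x∈p∪q⁻ (current k) (zone (suc k)) (subst (v ∈_) c≡ v∈)
  ...   | inj₁ v∈c = trans (∈-current⁻ k v∈c) (sym b≡)
  ...   | inj₂ v∈z = cong blockOf (∈-subset⁻ (λ v → p v ≟ suc k) v∈z)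

  block : ℕ → Subset N
  block β = subset (λ v → blockOf (p v) ≟ β)

  ∈-block⁻ : ∀ {v β} → v ∈ block β → blockOf (p v) ≡ β
  ∈-block⁻ {β = β} = ∈-subset⁻ (λ v → blockOf (p v) ≟ β)

  -- Descending from `t`, let `k` be the first zone index met that belongs to block `β`. All
  -- vertices of the block have position at most `k`, so the block lies in `current k`.
  block≤2M : ∀ β → OmegaLe T (block β) (M + M)
  block≤2M β = bound t (λ {v} _ → p≤t v)
    where
    bound : ∀ k → (∀ {v} → v ∈ block β → p v ≤ k) → OmegaLe T (block β) (M + M)
    bound k p≤k with blockOf k ≟ β
    bound k p≤k | yes b≡β = OmegaLe-mono T
      (λ v∈ → ∈-current⁺ k (p≤k v∈) (trans (∈-block⁻ v∈) (sym b≡β))) ≤-refl (current≤2M k)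
    bound zero p≤0 | no b≢β = OmegaLe-empty T
      λ v∈ → b≢β (trans (cong blockOf (sym (n≤0⇒n≡0 (p≤0 v∈)))) (∈-block⁻ v∈))
    bound (suc k) p≤k | no b≢β = bound k λ v∈ → s≤s⁻¹ (≤∧≢⇒< (p≤k v∈)
      λ p≡ → b≢β (trans (cong blockOf (sym p≡)) (∈-block⁻ v∈)))

  -- A block is closed only when the next zone would push it beyond `2M`, and that zone contributes
  -- at most `M`. The premise `β < blockOf k` says that block `β` has been closed.
  block>M : ∀ {β} k → β < blockOf k → ¬ OmegaLe T (block β) M
  block>M {β} (suc k) β< ωβ with step k
  ... | same b≡ _ _ = block>M k (subst (β <_) b≡ β<) ωβ
  ... | new b≡ _ ¬h with m≤n⇒m<n∨m≡n (s≤s⁻¹ (subst (β <_) b≡ β<))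
  ...   | inj₁ β<b = block>M k β<b ωβ
  ...   | inj₂ refl = ¬h (OmegaLe-∪ T
    (OmegaLe-mono T (∈-subset⁺ (λ v → blockOf (p v) ≟ β) ∘ ∈-current⁻ k) ≤-refl ωβ) (zone≤M (suc k)))

-- Spread-out vertices of a large set

module _ {N : ℕ} (b : Fin N → ℕ) where

  level : ℕ → Subset N
  level β = subset (λ v → b v ≟ β)

  private
    from? : ∀ θ → Decidable (λ v → θ ≤ b v)
    from? θ v = θ ≤? b v

  from : Subset N → ℕ → Subset N
  from K θ = K ∩ subset (from? θ)

  argmin : ∀ {K u} → u ∈ K → ∃ λ v → v ∈ K × K ⊆ from K (b v)
  argmin {K} {u} u∈ =
    let q , q≤ , none , found = least attained? (suc (b u))
        w , w∈ , bw≡q = found (≤∧≢⇒< q≤ λ q≡ → none (subst (b u <_) (sym q≡) ≤-refl) (u , u∈ , refl))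
    in w , w∈ , λ {x} x∈ → x∈p∩q⁺ (x∈ , ∈-subset⁺ (from? (b w))
         (≮⇒≥ λ bx<bw → none (subst (b x <_) bw≡q bx<bw) (x , x∈ , refl)))
    where
    attained? : Decidable (λ β → ∃ λ v → v ∈ K × b v ≡ β)
    attained? β = Fin.any? λ v → v ∈? K ×-dec b v ≟ β

  ∣from∣-step : ∀ K {c} → (∀ β → ∣ K ∩ level β ∣ ≤ c) → ∀ θ → ∣ from K θ ∣ ≤ c + ∣ from K (suc θ) ∣
  ∣from∣-step K {c} level≤c θ = ≤-trans (∣p∣≤∣p∩q∣+∣p─q∣ (from K θ) (level θ)) (+-mono-≤
    (≤-trans (p⊆q⇒∣p∣≤∣q∣ λ v∈ → let v∈f , v∈l = x∈p∩q⁻ (from K θ) (level θ) v∈ in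
        x∈p∩q⁺ (p∩q⊆p K _ v∈f , v∈l)) (level≤c θ))
    (p⊆q⇒∣p∣≤∣q∣ λ {v} v∈ → let v∈K , θ≤ = x∈p∩q⁻ K (subset (from? θ)) (p─q⊆p (from K θ) (level θ) v∈) in
        x∈p∩q⁺ (v∈K , ∈-subset⁺ (from? (suc θ)) (≤∧≢⇒< (∈-subset⁻ (from? θ) θ≤)
          λ θ≡ → ∈-─⇒∉ (from K θ) (level θ) v∈ (∈-subset⁺ (λ v → b v ≟ θ) (sym θ≡))))))

  -- Greedy choice: take a vertex on the lowest level met by `K`, discard that level and the next
  -- three, at a cost of at most `4 * c`, and recurse.
  spread : ∀ m K {c} → (∀ β → ∣ K ∩ level β ∣ ≤ c) →
    ∣ K ∣ ≤ m * (4 * c) ⊎ Σ (Fin m → Fin N) λ v →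
      (∀ i → v i ∈ K) × (∀ {i j} → toℕ i < toℕ j → 4 + b (v i) ≤ b (v j))
  spread zero _ _ = inj₂ ((λ ()) , (λ ()) , λ { {()} })
  spread (suc m) K {c} level≤c with nonempty? K
  ... | no empty = inj₁ (≤-trans (≤-reflexive (trans (cong ∣_∣ (Empty-unique empty)) (∣⊥∣≡0 N))) z≤n)
  ... | yes (_ , u∈) with argmin u∈
  ...   | w , w∈ , K⊆ with spread m (from K (4 + b w)) {c}
            (λ β → ≤-trans (p⊆q⇒∣p∣≤∣q∣ λ v∈ →
              let v∈f , v∈l = x∈p∩q⁻ (from K (4 + b w)) (level β) v∈ in x∈p∩q⁺ (p∩q⊆p K _ v∈f , v∈l)) (level≤c β))
  ...     | inj₁ few = inj₁ (begin
    ∣ K ∣                                                ≤⟨ p⊆q⇒∣p∣≤∣q∣ K⊆ ⟩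
    ∣ from K θ ∣                                         ≤⟨ drop θ ⟩
    c + ∣ from K (1 + θ) ∣                               ≤⟨ +-monoʳ-≤ c (drop (1 + θ)) ⟩
    c + (c + ∣ from K (2 + θ) ∣)                         ≤⟨ +-monoʳ-≤ c (+-monoʳ-≤ c (drop (2 + θ))) ⟩
    c + (c + (c + ∣ from K (3 + θ) ∣))                   ≤⟨ +-monoʳ-≤ c (+-monoʳ-≤ c (+-monoʳ-≤ c (drop (3 + θ)))) ⟩
    c + (c + (c + (c + ∣ from K (4 + θ) ∣)))             ≤⟨ +-monoʳ-≤ c (+-monoʳ-≤ c (+-monoʳ-≤ c (+-monoʳ-≤ c few))) ⟩
    c + (c + (c + (c + m * (4 * c))))                    ≡⟨ regroup c (m * (4 * c)) ⟩
    suc m * (4 * c)                                      ∎)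
    where
    open ≤-Reasoning
    θ = b w
    drop : ∀ θ → ∣ from K θ ∣ ≤ c + ∣ from K (suc θ) ∣
    drop = ∣from∣-step K level≤c
    regroup : ∀ c x → c + (c + (c + (c + x))) ≡ 4 * c + x
    regroup = solve 2 (λ c x → c :+ (c :+ (c :+ (c :+ x))) := con 4 :* c :+ x) refl
      where open +-*-Solver
  ...     | inj₂ (v , v∈ , apart) = inj₂ (v⁺ , v⁺∈ , λ {i} {j} → v⁺-apart i j)
    where
    v⁺ : Fin (suc m) → Fin N
    v⁺ zero    = w
    v⁺ (suc i) = v i
    v⁺∈ : ∀ i → v⁺ i ∈ K
    v⁺∈ zero    = w∈
    v⁺∈ (suc i) = p∩q⊆p K _ (v∈ i)
    v⁺-apart : ∀ i j → toℕ i < toℕ j → 4 + b (v⁺ i) ≤ b (v⁺ j)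
    v⁺-apart zero    (suc j) _         = ∈-subset⁻ (from? (4 + b w)) (p∩q⊆q K _ (v∈ j))
    v⁺-apart (suc i) (suc j) (s≤s i<j) = apart i<j

-- The tournaments A_k

<ᵇ-true : ∀ {m n} → m < n → (m <ᵇ n) ≡ true
<ᵇ-true {m} {n} = dec-true (m <? n)

<ᵇ-false : ∀ {m n} → n ≤ m → (m <ᵇ n) ≡ false
<ᵇ-false {m} {n} n≤m = dec-false (m <? n) (≤⇒≯ n≤m)

<ᵇ-false⁻¹ : ∀ {m n} → (m <ᵇ n) ≡ false → n ≤ m
<ᵇ-false⁻¹ {m} {n} eq = ≮⇒≥ λ m<n → contradiction (trans (sym (<ᵇ-true m<n)) eq) λ ()

≡ᵇ-refl : ∀ m → (m ≡ᵇ m) ≡ true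
≡ᵇ-refl m = dec-true (m ≟ m) refl

≡ᵇ-false : ∀ {m n} → m ≢ n → (m ≡ᵇ n) ≡ false
≡ᵇ-false {m} {n} = dec-false (m ≟ n)

Aarc-total : ∀ k a b → Aarc k a b ≡ false → Aarc k b a ≡ false → a ≡ b
Aarc-total zero       tt tt _ _ = refl
Aarc-total (suc zero) tt tt _ _ = refl
Aarc-total (suc (suc j)) (inj₁ (s , x)) (inj₁ (t , y)) p q with s Fin.≟ t
... | yes refl rewrite ≡ᵇ-refl (toℕ s) = cong (inj₁ ∘ (s ,_)) (Aarc-total (suc j) x y p q)
... | no s≢t rewrite ≡ᵇ-false (s≢t ∘ Fin.toℕ-injective)
                   | ≡ᵇ-false (s≢t ∘ sym ∘ Fin.toℕ-injective) =
  contradiction (Fin.toℕ-injective (≤-antisym (<ᵇ-false⁻¹ q) (<ᵇ-false⁻¹ p))) s≢t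
Aarc-total (suc (suc j)) (inj₁ (s , _)) (inj₂ b) p q =
  contradiction (<ᵇ-false⁻¹ {toℕ s} p) (<⇒≱ (<ᵇ-false⁻¹ {toℕ b} q))
Aarc-total (suc (suc j)) (inj₂ a) (inj₁ (t , _)) p q =
  contradiction (<ᵇ-false⁻¹ {toℕ t} q) (<⇒≱ (<ᵇ-false⁻¹ {toℕ a} p))
Aarc-total (suc (suc j)) (inj₂ a) (inj₂ b) p q =
  cong inj₂ (Fin.toℕ-injective (≤-antisym (<ᵇ-false⁻¹ p) (<ᵇ-false⁻¹ q)))

length-cartesianProduct : ∀ {X Y : Set} (xs : List X) (ys : List Y) →
  length (cartesianProduct xs ys) ≡ length xs * length ys
length-cartesianProduct []       ys = refl
length-cartesianProduct (x ∷ xs) ys = trans (length-++ (map (x ,_) ys))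
  (cong₂ _+_ (length-map (x ,_) ys) (length-cartesianProduct xs ys))

A-vertices : ∀ k → List (AV k)
A-vertices zero          = tt ∷ []
A-vertices (suc zero)    = tt ∷ []
A-vertices (suc (suc j)) =
  map inj₂ (allFin (suc (suc j))) ++ map inj₁ (cartesianProduct (allFin (suc j)) (A-vertices (suc j)))

∈-A-vertices : ∀ k a → a ∈ˡ A-vertices k
∈-A-vertices zero          tt = here refl
∈-A-vertices (suc zero)    tt = here refl
∈-A-vertices (suc (suc j)) (inj₂ a) = ∈-++⁺ˡ (∈-map⁺ inj₂ (∈-allFin a))
∈-A-vertices (suc (suc j)) (inj₁ (s , x)) = ∈-++⁺ʳ (map inj₂ (allFin (suc (suc j))))
  (∈-map⁺ inj₁ (∈-cartesianProduct⁺ (∈-allFin s) (∈-A-vertices (suc j) x)))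

∣A∣ : ℕ → ℕ
∣A∣ k = length (A-vertices k)

∣A∣-rec : ∀ j → ∣A∣ (2 + j) ≡ 2 + j + suc j * ∣A∣ (suc j)
∣A∣-rec j = begin
  length (map inj₂ (allFin (2 + j)) ++ map inj₁ P)      ≡⟨ length-++ (map inj₂ (allFin (2 + j))) ⟩
  length (map inj₂ (allFin (2 + j))) + length (map inj₁ P) ≡⟨ cong₂ _+_ (length-map inj₂ (allFin (2 + j))) (length-map inj₁ P) ⟩
  length (allFin (2 + j)) + length P
    ≡⟨ cong₂ _+_ (length-tabulate {n = 2 + j} id)
         (length-cartesianProduct (allFin (suc j)) (A-vertices (suc j))) ⟩
  2 + j + length (allFin (suc j)) * ∣A∣ (suc j)         ≡⟨ cong (λ l → 2 + j + l * ∣A∣ (suc j)) (length-tabulate {n = suc j} id) ⟩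
  2 + j + suc j * ∣A∣ (suc j)                           ∎
  where
  open ≡-Reasoning
  P = cartesianProduct (allFin (suc j)) (A-vertices (suc j))

-- The recursion multiplies by `j + 1` while the factorial grows by the factor `j + 2`. The spare
-- `4 * (suc j) !` absorbs the `j + 2` new vertices.
∣A∣≤ : ∀ j → ∣A∣ (suc j) ≤ 4 * (suc j) !
∣A∣≤ zero    = s≤s z≤n
∣A∣≤ (suc j) = begin
  ∣A∣ (2 + j)                     ≡⟨ ∣A∣-rec j ⟩
  2 + j + suc j * ∣A∣ (suc j)     ≤⟨ +-mono-≤ 2+j≤4q (*-monoʳ-≤ (suc j) (∣A∣≤ j)) ⟩
  4 * q + suc j * (4 * q)         ≡⟨ solve 2 (λ i q → con 4 :* q :+ i :* (con 4 :* q) := con 4 :* (q :+ i :* q)) refl (suc j) q ⟩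
  4 * (2 + j) !                   ∎
  where
  open ≤-Reasoning
  open +-*-Solver
  q = (suc j) !
  2+j≤4q : 2 + j ≤ 4 * q
  2+j≤4q = begin
    2 + j              ≤⟨ m≤m+n (2 + j) (2 + 3 * j) ⟩
    2 + j + (2 + 3 * j) ≡⟨ solve 1 (λ j → con 2 :+ j :+ (con 2 :+ con 3 :* j) := con 4 :* (con 1 :+ j)) refl j ⟩
    4 * suc j          ≤⟨ *-monoʳ-≤ 4 (m≤m*n (suc j) (j !) {{j !≢0}}) ⟩
    4 * q              ∎

-- Copies of `A_m` from spread-out cliques

module AFree {N : ℕ} (T : Tour N) (j s : ℕ)
  (A-free : ¬ Contains T V (A (suc (suc j))))
  (A-rich : ∀ X → AtLeast T X s → Contains T X (A (suc j))) where

  private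
    m a : ℕ
    m = suc (suc j)
    a = ∣A∣ (suc j)

  -- Copies are chosen from the last set to the first; each vertex of a later copy costs s in W i.
  choose-copies : ∀ k (W : Fin k → Subset N) → (∀ i → AtLeast T (W i) (k * a * s + s)) →
    (∀ {i i′} → toℕ i < toℕ i′ → Linked T s (W i) (W i′)) →
    Σ (∀ i → Contains T (W i) (A (suc j))) λ g →
      ∀ {i i′} → toℕ i < toℕ i′ → ∀ x y → arc T (proj₁ (g i) x) (proj₁ (g i′) y) ≡ true
  choose-copies zero    W _   _    = (λ ()) , λ { {()} }
  choose-copies (suc k) W big link = g⁺ , λ {i} {i′} → g⁺-arcs i i′
    where
    rest = choose-copies k (W ∘ suc)
      (λ i → AtLeast-mono T id (+-monoˡ-≤ s (*-monoˡ-≤ s (m≤n+m (k * a) a))) (big (suc i)))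
      (λ i<i′ → link (s≤s i<i′))
    g : ∀ i → Contains T (W (suc i)) (A (suc j))
    g = proj₁ rest
    at : Fin k × AV (suc j) → Fin N
    at (i , x) = proj₁ (g i) x
    at∈ : ∀ ix → at ix ∈ W (suc (proj₁ ix))
    at∈ (i , x) = proj₁ (proj₂ (proj₂ (g i))) x
    ixs : List (Fin k × AV (suc j))
    ixs = cartesianProduct (allFin k) (A-vertices (suc j))
    length-ixs : length (map at ixs) ≡ k * a
    length-ixs = trans (length-map at ixs) (trans (length-cartesianProduct (allFin k) (A-vertices (suc j)))
      (cong (_* a) (length-tabulate {n = k} id)))
    avoided = avoid-N⁺ T (map at ixs) {W zero} {s} {s}
      (λ u∈ → let ix , _ , u≡ = ∈-map⁻ at u∈ in
        few-out (link (s≤s z≤n)) (subst (_∈ W (suc (proj₁ ix))) (sym u≡) (at∈ ix)))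
      (AtLeast-mono T id (+-monoˡ-≤ s (*-monoˡ-≤ s (≤-trans (≤-reflexive length-ixs) (m≤n+m (k * a) a)))) (big zero))
    Y = proj₁ avoided
    Y⊆ : Y ⊆ W zero
    Y⊆ = proj₁ (proj₂ avoided)
    g₀ : Contains T Y (A (suc j))
    g₀ = A-rich Y (proj₂ (proj₂ (proj₂ avoided)))
    g⁺ : ∀ i → Contains T (W i) (A (suc j))
    g⁺ zero    = let f , inj , f∈ , arcs = g₀ in f , inj , (λ x → Y⊆ (f∈ x)) , arcs
    g⁺ (suc i) = g i
    g⁺-arcs : ∀ i i′ → toℕ i < toℕ i′ → ∀ x y → arc T (proj₁ (g⁺ i) x) (proj₁ (g⁺ i′) y) ≡ true
    g⁺-arcs zero (suc i′) _ x y = proj₁ (proj₂ (proj₂ avoided))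
      (∈-map⁺ at (∈-cartesianProduct⁺ (∈-allFin i′) (∈-A-vertices (suc j) y)))
      (proj₁ (proj₂ (proj₂ g₀)) x)
      λ eq → disjoint (link {zero} {suc i′} (s≤s z≤n)) (Y⊆ (proj₁ (proj₂ (proj₂ g₀)) x))
        (subst (_∈ W (suc i′)) eq (at∈ (i′ , y)))
    g⁺-arcs (suc i) (suc i′) (s≤s i<i′) x y = proj₂ rest i<i′ x y

  -- Here `v i` stands for `v_{i+1}` and `g t` for `T_{t+1}`; both indices shift by one, so the
  -- comparisons of the definition are unchanged.
  no-A-layout : (v : Fin m → Fin N) → (∀ {i i′} → toℕ i < toℕ i′ → arc T (v i′) (v i) ≡ true) →
    (g : Fin (suc j) → AV (suc j) → Fin N) →
    (∀ t x y → Aarc (suc j) x y ≡ arc T (g t x) (g t y)) →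
    (∀ {t t′} → toℕ t < toℕ t′ → ∀ x y → arc T (g t x) (g t′ y) ≡ true) →
    (∀ {i t} → toℕ i ≤ toℕ t → ∀ x → arc T (v i) (g t x) ≡ true) →
    (∀ {i t} → toℕ t < toℕ i → ∀ x → arc T (g t x) (v i) ≡ true) → Empty
  no-A-layout v vv g g-arcs gg vg gv =
    A-free (contains T f (Aarc-total m) (λ _ → ∈⊤) arcs)
    where
    f : AV m → Fin N
    f (inj₁ (t , x)) = g t x
    f (inj₂ i)       = v i
    arcs : ∀ a b → Aarc m a b ≡ arc T (f a) (f b)
    arcs (inj₁ (t , x)) (inj₁ (t′ , y)) with <-cmp (toℕ t) (toℕ t′)
    ... | tri< lt t≢ _ rewrite ≡ᵇ-false t≢ = trans (<ᵇ-true lt) (sym (gg lt x y))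
    ... | tri> _ t≢ gt rewrite ≡ᵇ-false t≢ = trans (<ᵇ-false (<⇒≤ gt)) (sym (arc-asym T (gg gt y x)))
    ... | tri≈ _ t≡ _ with refl ← Fin.toℕ-injective t≡ rewrite ≡ᵇ-refl (toℕ t) = g-arcs t x y
    arcs (inj₂ i) (inj₂ i′) with <-cmp (toℕ i) (toℕ i′)
    ... | tri< lt _ _ = trans (<ᵇ-false (<⇒≤ lt)) (sym (arc-asym T (vv lt)))
    ... | tri> _ _ gt = trans (<ᵇ-true gt) (sym (vv gt))
    ... | tri≈ _ i≡ _ with refl ← Fin.toℕ-injective i≡ = trans (<ᵇ-false {toℕ i} ≤-refl) (sym (irrefl T (v i)))
    arcs (inj₂ i) (inj₁ (t , x)) with toℕ i ≤? toℕ t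
    ... | yes i≤t = trans (<ᵇ-true (s≤s i≤t)) (sym (vg i≤t x))
    ... | no i≰t  = trans (<ᵇ-false (≰⇒> i≰t)) (sym (arc-asym T (gv (≰⇒> i≰t) x)))
    arcs (inj₁ (t , x)) (inj₂ i) with toℕ i ≤? toℕ t
    ... | yes i≤t = trans (<ᵇ-false i≤t) (sym (arc-asym T (vg i≤t x)))
    ... | no i≰t  = trans (<ᵇ-true (≰⇒> i≰t)) (sym (gv (≰⇒> i≰t) x))

  module _ (b : Fin N → ℕ)
    (far : ∀ {X Y} → (∀ {x y} → x ∈ X → y ∈ Y → 2 + b x ≤ b y) → Linked T s X Y)
    (level-big : ∀ {β v} → β < b v → AtLeast T (level b β) ((4 * m ! + 1) * s)) where

    -- The backward arcs among the `v i` are those of the vertices `v_1, …, v_m` of `A_m`. It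
    -- remains to place a copy of `A_{m-1}` in a level between each two consecutive ones.
    no-spread-clique : (v : Fin m → Fin N) → (∀ {i i′} → toℕ i < toℕ i′ → 4 + b (v i) ≤ b (v i′)) →
      (∀ {i i′} → toℕ i < toℕ i′ → arc T (v i′) (v i) ≡ true) → Empty
    no-spread-clique v apart vv =
      no-A-layout v vv (λ t → proj₁ (proj₁ copies t)) (λ t → proj₂ (proj₂ (proj₂ (proj₁ copies t))))
        (proj₂ copies) vg gv
      where
      -- Consecutive chosen vertices are 4 levels apart, so this level has distance at least 2, as
      -- `far` demands, from both of its neighbours.
      gap : Fin (suc j) → ℕ
      gap t = 2 + b (v (inject₁ t))

      before : ∀ {i t} → toℕ i ≤ toℕ t → 2 + b (v i) ≤ gap t
      before {i} {t} i≤t with m≤n⇒m<n∨m≡n i≤t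
      ... | inj₁ i<t = ≤-trans (m≤n+m _ 2) (≤-trans (apart (subst (toℕ i <_) (sym (Fin.toℕ-inject₁ t)) i<t)) (m≤n+m _ 2))
      ... | inj₂ i≡t = ≤-reflexive (cong (λ k → 2 + b (v k)) (Fin.toℕ-injective (trans i≡t (sym (Fin.toℕ-inject₁ t)))))

      after : ∀ {i t} → toℕ t < toℕ i → 2 + gap t ≤ b (v i)
      after {i} {t} t<i = apart (subst (_< toℕ i) (sym (Fin.toℕ-inject₁ t)) t<i)

      in-gap : ∀ {t w} → w ∈ level b (gap t) → b w ≡ gap t
      in-gap {t} = ∈-subset⁻ (λ w → b w ≟ gap t)

      -- The neighbours of `v i` whose arcs have the wrong direction for a copy placed in gap `t`.
      bad : Fin (suc j) → Fin m → Subset N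
      bad t i with toℕ i ≤? toℕ t
      ... | yes _ = N⁻ T (v i)
      ... | no _  = N⁺ T (v i)

      bad-≤ : ∀ {t i} → toℕ i ≤ toℕ t → bad t i ≡ N⁻ T (v i)
      bad-≤ {t} {i} i≤t with toℕ i ≤? toℕ t
      ... | yes _  = refl
      ... | no i≰t = contradiction i≤t i≰t

      bad-> : ∀ {t i} → toℕ t < toℕ i → bad t i ≡ N⁺ T (v i)
      bad-> {t} {i} t<i with toℕ i ≤? toℕ t
      ... | yes i≤t = contradiction t<i (≤⇒≯ i≤t)
      ... | no _    = refl

      bad-small : ∀ t i → OmegaLt T (bad t i ∩ level b (gap t)) s
      bad-small t i with toℕ i ≤? toℕ t
      -- Links join sets, so `v i` enters as a singleton.
      ... | yes i≤t = few-in (far {⁅ v i ⁆} λ x∈ y∈ →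
        subst₂ (λ x k → 2 + b x ≤ k) (sym (x∈⁅y⁆⇒x≡y _ x∈)) (sym (in-gap {t} y∈)) (before i≤t)) (x∈⁅x⁆ (v i))
      ... | no i≰t = few-out (far {Y = ⁅ v i ⁆} λ x∈ y∈ →
        subst₂ (λ k y → 2 + k ≤ b y) (sym (in-gap {t} x∈)) (sym (x∈⁅y⁆⇒x≡y _ y∈)) (after {i} {t} (≰⇒> i≰t))) (x∈⁅x⁆ (v i))

      -- Each gap pays `s` for every `v i`, `s` for every vertex of the `m - 1` copies, and keeps
      -- `s`. The vertices counted are exactly those of `A_m`, whence `4 * m ! + 1`.
      enough : ∀ t → length (map (bad t) (allFin m)) * s + (suc j * a * s + s) ≤ (4 * m ! + 1) * s
      enough t = begin
        length (map (bad t) (allFin m)) * s + (suc j * a * s + s)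
          ≡⟨ cong (λ l → l * s + (suc j * a * s + s))
               (trans (length-map (bad t) (allFin m)) (length-tabulate {n = m} id)) ⟩
        m * s + (suc j * a * s + s)
          ≡⟨ solve 3 (λ m k s → m :* s :+ (k :* s :+ s) := (m :+ k :+ con 1) :* s) refl m (suc j * a) s ⟩
        (m + suc j * a + 1) * s       ≡⟨ cong (λ l → (l + 1) * s) (∣A∣-rec j) ⟨
        (∣A∣ m + 1) * s               ≤⟨ *-monoˡ-≤ s (+-monoˡ-≤ 1 (∣A∣≤ (suc j))) ⟩
        (4 * m ! + 1) * s             ∎
        where
        open ≤-Reasoning
        open +-*-Solver

      shrunk : ∀ t → ∃ λ Y → Y ⊆ level b (gap t)
        × (∀ {S w} → S ∈ˡ map (bad t) (allFin m) → w ∈ Y → w ∉ S) × AtLeast T Y (suc j * a * s + s)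
      shrunk t = remove T (map (bad t) (allFin m))
        (λ S∈ → let i , _ , S≡ = ∈-map⁻ (bad t) {xs = allFin m} S∈ in
          subst (λ S → OmegaLt T (S ∩ level b (gap t)) s) (sym S≡) (bad-small t i))
        -- The vertex `v (suc t)` lies beyond gap `t`, so `level-big` applies to this level.
        (AtLeast-mono T id (enough t) (level-big (<⇒≤ (after {suc t} {t} ≤-refl))))

      W : Fin (suc j) → Subset N
      W t = proj₁ (shrunk t)

      W⊆ : ∀ t → W t ⊆ level b (gap t)
      W⊆ t = proj₁ (proj₂ (shrunk t))

      b-W : ∀ {t w} → w ∈ W t → b w ≡ gap t
      b-W {t} w∈ = in-gap {t} (W⊆ t w∈)

      not-bad : ∀ t i {w} → w ∈ W t → w ∉ bad t i
      not-bad t i = proj₁ (proj₂ (proj₂ (shrunk t))) (∈-map⁺ (bad t) (∈-allFin i))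

      copies = choose-copies (suc j) W (λ t → proj₂ (proj₂ (proj₂ (shrunk t))))
        λ {t} {t′} t<t′ → far λ x∈ y∈ → subst₂ (λ k l → 2 + k ≤ l) (sym (b-W x∈)) (sym (b-W y∈))
          (≤-trans (after {inject₁ t′} {t} (subst (toℕ t <_) (sym (Fin.toℕ-inject₁ t′)) t<t′)) (m≤n+m _ 2))

      copy∈ : ∀ t x → proj₁ (proj₁ copies t) x ∈ W t
      copy∈ t = proj₁ (proj₂ (proj₂ (proj₁ copies t)))

      vg : ∀ {i t} → toℕ i ≤ toℕ t → ∀ x → arc T (v i) (proj₁ (proj₁ copies t) x) ≡ true
      vg {i} {t} i≤t x = arc-total T
        (λ eq → <-irrefl (trans (cong b (sym eq)) (b-W (copy∈ t x))) (<-trans ≤-refl (before {i} {t} i≤t)))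
        (Bool.¬-not λ e → not-bad t i (copy∈ t x)
          (subst (_ ∈_) (sym (bad-≤ i≤t)) (∈-tabulate⁺ e)))

      gv : ∀ {i t} → toℕ t < toℕ i → ∀ x → arc T (proj₁ (proj₁ copies t) x) (v i) ≡ true
      gv {i} {t} t<i x = arc-total T
        (λ eq → <-irrefl (sym (trans (cong b eq) (b-W (copy∈ t x)))) (<-trans ≤-refl (after {i} {t} t<i)))
        (Bool.¬-not λ e → not-bad t i (copy∈ t x)
          (subst (_ ∈_) (sym (bad-> t<i)) (∈-tabulate⁺ e)))

-- The ordering by blocks

-- The left side is `spread`'s bound with `c = M + M`, the largest possible part of a clique in one
-- block.
8mM≤16mM : ∀ m M → m * (4 * (M + M)) ≤ 16 * m * M
8mM≤16mM m M = ≤-trans (m≤m+n _ (8 * m * M)) (≤-reflexive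
  (solve 2 (λ m M → m :* (con 4 :* (M :+ M)) :+ con 8 :* m :* M := con 16 :* m :* M) refl m M))
  where open +-*-Solver

module _ {N : ℕ} (T : Tour N) (j s t M : ℕ) (p : Fin N → ℕ)
  (A-free : ¬ Contains T V (A (suc (suc j))))
  (A-rich : ∀ X → AtLeast T X s → Contains T X (A (suc j)))
  (p≤t : ∀ v → p v ≤ t)
  (zone≤M : ∀ k → OmegaLe T (subset (λ v → p v ≟ k)) M)
  (far⇒Linked : ∀ {X Y} → (∀ {x y} → x ∈ X → y ∈ Y → 3 + p x ≤ p y) → Linked T s X Y)
  (M-large : (4 * suc (suc j) ! + 1) * s ≤ M) where

  open Blocks T p t M p≤t zone≤M

  private
    b : Fin N → ℕ
    b v = blockOf (p v)

  far-blocks⇒Linked : ∀ {X Y} → (∀ {x y} → x ∈ X → y ∈ Y → 2 + b x ≤ b y) → Linked T s X Y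
  far-blocks⇒Linked far = far⇒Linked λ x∈ y∈ → blockOf-far (far x∈ y∈)

  block-big : ∀ {β v} → β < b v → AtLeast T (block β) ((4 * suc (suc j) ! + 1) * s)
  block-big {v = v} β< small =
    block>M (p v) β< (OmegaLe-mono T id M-large (OmegaLt⇒OmegaLe T small))

  omega≤ : OmegaLe T V (16 * suc (suc j) * M)
  omega≤ with OmegaLe-concat T b block (λ _ → M + M) block≤2M
  ... | pos , pos-inj , pos-mono , cliques = pos , pos-inj , λ K _ K-clique →
    [ (λ few → ≤-trans few (8mM≤16mM (suc (suc j)) M))
    , (λ { (v , v∈ , apart) → ⊥-elim (AFree.no-spread-clique T j s A-free A-rich b
             far-blocks⇒Linked block-big v apart
             λ i<i′ → backward K-clique (v∈ _) (v∈ _) (<-≤-trans (s≤s (m≤n+m _ 3)) (apart i<i′))) })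
    ]′ (spread b (suc (suc j)) K {M + M} λ β →
      cliques β (K ∩ block β) (p∩q⊆q K (block β)) (∈-block⁻ ∘ p∩q⊆q K (block β))
        λ u v u∈ v∈ → K-clique u v (p∩q⊆p K (block β) u∈) (p∩q⊆p K (block β) v∈))
    where
    -- The ordering sorts by block first, so a backedge between different blocks points from the
    -- later block to the earlier one.
    backward : ∀ {K u v} → Clique T pos K → u ∈ K → v ∈ K → b u < b v → arc T v u ≡ true
    backward {K} {u} {v} K-clique u∈ v∈ bu<bv
      with K-clique u v u∈ v∈ (λ eq → <-irrefl (cong b eq) bu<bv)
    ... | inj₁ (_ , a)  = a
    ... | inj₂ (gt , _) = contradiction (pos-mono bu<bv) (<⇒≯ gt)

theorem6p1 : (m n c-small c-large : ℕ) → 2 ≤ m → 2 ≤ n → 2 ^ n * c-small ≤ c-large →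
    (C : ℕ → ℕ → ℕ) →
    (∀ (x y N : ℕ) (T′ : Tour N) →
    (∀ (X : Subset N) → ¬ OmegaLt T′ X y → Contains T′ X (D (n ∸ 1))) →
    OmegaLt T′ V (C x y) ⊎ Contains T′ V (D n) ⊎ BagChain T′ x y 8) →
    (N : ℕ) (T : Tour N) →
    ¬ Contains T V (A m) → ¬ Contains T V (D n) →
    (∀ (X : Subset N) → ¬ OmegaLt T X c-small →
    Contains T X (A (m ∸ 1)) × Contains T X (D (n ∸ 1))) →
    OmegaLe T V (16 * m * (c-large ⊔ C c-large c-small ⊔ (4 * (m !) + 1) * c-small))
theorem6p1 (suc (suc j)) (suc (suc n)) s L (s≤s (s≤s z≤n)) (s≤s (s≤s z≤n)) 2ⁿs≤L C C-spec N T A-free D-free rich =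
  let p , t , p≤t , zone≤C , far⇒Linked = zoning L (C L s) h+h≤L dichotomy
  in omega≤ T j s t _ p A-free (λ X big → proj₁ (rich X big)) p≤t
       (λ k → OmegaLe-mono T id (≤-trans (m≤n⊔m L (C L s)) (m≤m⊔n _ _)) (zone≤C k))
       far⇒Linked (m≤n⊔m (L ⊔ C L s) _)
  where
  open DFree T n s D-free (λ X big → proj₂ (rich X big))

  -- The matched `n` is two less than that of the theorem, so `h + h` is the assumed lower bound on
  -- `L`.
  h+h≤L : h + h ≤ L
  h+h≤L = ≤-trans (≤-reflexive (trans (sym (*-distribʳ-+ s (2 ^ suc n) (2 ^ suc n)))
    (cong (λ k → (2 ^ suc n + k) * s) (sym (+-identityʳ (2 ^ suc n)))))) 2ⁿs≤L

  -- The hypothesis on `C` speaks of whole tournaments, so it is applied to the one induced on `Z`,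
  -- which inherits richness in copies of `D_{n-1}`. A copy of `D_n` there would be one in `T`.
  dichotomy : ∀ Z → OmegaLt T Z (C L s) ⊎ (Σ (Chain T L s 8) λ 𝓜 → ∀ i → bag 𝓜 i ⊆ Z)
  dichotomy Z =
    [ inj₁ ∘ OmegaLt-extend-V
    , [ (λ D-in → contradiction (Contains-extend D-in) D-free) , inj₂ ∘ BagChain-extend ]′
    ]′ (C-spec L s ∣ Z ∣ induced
         λ X big → Contains-restrict (proj₂ (rich (image X) (big ∘ OmegaLt-restrict))))
    where open Induced T Z
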